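{- Let $k=\mathbb F_2$, let $Q=\langle X,E\rangle$ be a graph with a chosen edge $\tilde e=\{\tilde x,\tilde y\}$, and let $\Gamma(Q),\Gamma'(Q)$ be the two $2$-colored Cai–Fürer–Immerman graphs on the common colored vertex set $X(Q)=X_1(Q)\cup X_2(Q)$. If $\Gamma(Q)$ and $\Gamma'(Q)$ are nonisomorphic, then there exists a $3$-constructible functor $\mathcal F:\mathcal C_3(V)\to\mathcal C_3(V')$ with $\dim\mathcal F(\{A_{\Gamma(Q)}\})\ne\dim\mathcal F(\{A_{\Gamma'(Q)}\})$. In particular $A_{\Gamma(Q)}$ and $A_{\Gamma'(Q)}$ are not isomorphic in $\mathcal C_3(V)$.
   Context: CFI construction: $E(x)$ is the set of edges containing $x$. $X_1(Q)=\{c_{x,Y}:x\in X, Y\subseteq E(x),|Y|\text{ even}\}$, $X_2(Q)=\{a_{x,e},b_{x,e}:x\in X,e\in E(x)\}$. The edge set $E(Q)$ consists of $\{a_{x,e},c_{x,Y}\}$ for $e\in Y$, $\{b_{x,e},c_{x,Y}\}$ for $e\in E(x)\setminus Y$, and $\{a_{x,e},a_{y,e}\}$, $\{b_{x,e},b_{y,e}\}$ for every edge $e=\{x,y\}\in E$. $E'(Q)$ is obtained from $E(Q)$ by removing $\{a_{\tilde x,\tilde e},a_{\tilde y,\tilde e}\}$ and $\{b_{\tilde x,\tilde e},b_{\tilde y,\tilde e}\}$ and adding $\{a_{\tilde x,\tilde e},b_{\tilde y,\tilde e}\}$ and $\{a_{\tilde y,\tilde e},b_{\tilde x,\tilde e}\}$.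 $\Gamma(Q)$ (resp. $\Gamma'(Q)$) is the graph on $X(Q)$ with edges $E(Q)$ (resp. $E'(Q)$) and color classes $X_1(Q),X_2(Q)$; isomorphisms must preserve colors. Encoding: $G=\Sigma(X(Q))$ as a finite constant algebraic group over $k$ ($R=k[G]$ functions on $G$, $\Delta f(g,h)=f(gh)$, $\sigma_e f=f(e)$, $\iota f(g)=f(g^{ -1})$); $U=k^{X(Q)}$ with permutation action; $W$ = span of the constant $1$ and matrix coefficients $g\mapsto g_{u,v}$; $R_0=k$, $R_d=W^d$. $V=U\otimes U\oplus U\oplus U\oplus k$ and for a colored graph $\Gamma$ with symmetric edge relation $\mathcal R$, $A_\Gamma=(\sum_{(u,v)\in\mathcal R}u\otimes v,\ \sum_{u\in X_1(Q)}u,\ \sum_{u\in X_2(Q)}u,\ 1)$. A representation is a coassociative counital $\mu:V\to V\otimes R$; $\ell(V)$ is the least $\ell$ with $\mu(V)\subseteq V\otimes R_\ell$; linear $f$ is equivariant if $\mu'\circ f=(f\otimes\mathrm{id})\circ\mu$. $\mathcal C_3(V)$: for a subspace $S\subseteq R_3$, $(S)_3=\sum_{e\le3}(S\cap R_e)R_{3-e}$, $((S))_3$ = smallest $J\supseteq S$ with $(J)_3=J$. Objects: affine subspaces of $V$ (incl. $\emptyset$; $v\equiv\{v\}$). For nonempty $X_1=v_1+Z_1,X_2=v_2+Z_2$, $S(X_1,X_2)$ = span of $(f\otimes\mathrm{id})\mu(w)-f(v_2)1$, $f\in V^*$ vanishing on $Z_2$, $w\in X_1$; $S(\emptyset,\cdot)=0$,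 $S(X,\emptyset)=k1$. $\operatorname{Hom}_3(X_1,X_2)=(R_3/((S(X_1,X_2)))_3)^*\subseteq R_3^*$, composition $r\mapsto(\psi\otimes\varphi)\Delta(r)$. $3$-constructible functors: smallest class of very faithful functors (covariant: $\phi\mapsto\phi$; contravariant: $\phi\mapsto\phi\circ\iota$; between $\mathcal C_3(V),\mathcal C_3(V')$ with $\ell\le3$) containing constant covariant functors with values $\emptyset,\{0\},V',\{\lambda\}\in\operatorname{Aff}(k)$, $X\mapsto f(X)$ for equivariant linear $f$, the contravariant $X\mapsto\{f\in V^*:f|_X\equiv1\}$, and closed under $X\mapsto\mathcal F'(X)\oplus\mathcal F''(X)$, $X\mapsto\mathcal F'(X)\otimes\mathcal F''(X)$ (affine span of all $y\otimes y'$; needs $\ell(V')+\ell(V'')\le3$; same variance), and composition. $\dim\emptyset=-\infty$. -}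

module Defs where

open import Data.Bool using (Bool; true; false; _∧_; _∨_; _xor_; not; T)
open import Data.Nat using (ℕ; zero; suc; _+_; _*_; _≤_; _∸_)
open import Data.Fin using (Fin; zero; suc; splitAt; remQuot; _≟_)
open import Data.Vec using (Vec; []; _∷_; lookup; tabulate; replicate; zipWith; take; drop)
import Data.List as L
open import Data.List using (List; length)
open import Data.List.Relation.Unary.All using (All)
open import Data.Maybe using (Maybe; just; nothing)
open import Data.Product using (Σ; _×_; _,_; proj₁; proj₂)
open import Data.Sum using (_⊎_; inj₁; inj₂)
open import Relation.Binary.PropositionalEquality using (_≡_)
open import Relation.Nullary using (¬_)
open import Relation.Nullary.Decidable using (⌊_⌋)
open import Data.Empty using (⊥)
open import Data.Unit using (⊤; tt)
open import Function.Bundles using (_↔_; Inverse)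
open import Data.Vec using (_++_)

-- The field k = 𝔽₂ is Bool with _xor_ as addition and _∧_ as product.
-- Vectors of k^d are Vec Bool d.

ΣF : (n : ℕ) → (Fin n → Bool) → Bool
ΣF zero    f = false
ΣF (suc n) f = f zero xor ΣF n (λ i → f (suc i))

allF : (n : ℕ) → (Fin n → Bool) → Bool
allF zero    f = true
allF (suc n) f = f zero ∧ allF n (λ i → f (suc i))

eqF : {n : ℕ} → Fin n → Fin n → Bool
eqF i j = ⌊ i ≟ j ⌋

oddB : ℕ → Bool
oddB zero    = false
oddB (suc n) = not (oddB n)

Subset : ℕ → Set₁
Subset d = Vec Bool d → Set

_+ᵥ_ : {d : ℕ} → Vec Bool d → Vec Bool d → Vec Bool d
_+ᵥ_ = zipWith _xor_

0ᵥ : {d : ℕ} → Vec Bool d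
0ᵥ = replicate _ false

sumᵥ : {d : ℕ} → List (Vec Bool d) → Vec Bool d
sumᵥ = L.foldr _+ᵥ_ 0ᵥ

-- the pairing V* × V → k (dual vectors written in the dual basis)
dot : {d : ℕ} → Vec Bool d → Vec Bool d → Bool
dot {d} f x = ΣF d (λ i → lookup f i ∧ lookup x i)

_⊗ᵥ_ : {a b : ℕ} → Vec Bool a → Vec Bool b → Vec Bool (a * b)
_⊗ᵥ_ {a} {b} y y' = tabulate (λ i → lookup y (proj₁ (remQuot {a} b i)) ∧ lookup y' (proj₂ (remQuot {a} b i)))

lincomb : {d m : ℕ} → Vec Bool m → Vec (Vec Bool d) m → Vec Bool d
lincomb []       []       = 0ᵥ
lincomb (c ∷ cs) (b ∷ bs) = (if' c b) +ᵥ lincomb cs bs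
  where
  if' : {d : ℕ} → Bool → Vec Bool d → Vec Bool d
  if' true  v = v
  if' false v = 0ᵥ

InSpan : {d m : ℕ} → Vec (Vec Bool d) m → Vec Bool d → Set
InSpan {d} {m} bs u = Σ (Vec Bool m) (λ c → lincomb c bs ≡ u)

LinIndep : {d m : ℕ} → Vec (Vec Bool d) m → Set
LinIndep {d} {m} bs = (c : Vec Bool m) → lincomb c bs ≡ 0ᵥ → c ≡ replicate m false

-- dimension of an affine subspace; nothing stands for dim ∅ = -∞.
-- HasDim X (just m): X = v + Z with Z spanned by m linearly independent vectors.
HasDim : {d : ℕ} → Subset d → Maybe ℕ → Set
HasDim {d} X nothing  = (w : Vec Bool d) → ¬ X w
HasDim {d} X (just m) =
  Σ (Vec Bool d) λ v → Σ (Vec (Vec Bool d) m) λ bs → LinIndep bs ×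
    ((w : Vec Bool d) → (X w → InSpan bs (w +ᵥ v)) × (InSpan bs (w +ᵥ v) → X w))

AffSpan : {d : ℕ} → Subset d → Subset d
AffSpan P w = Σ (List (Vec Bool _)) λ ps → All P ps × T (oddB (length ps)) × sumᵥ ps ≡ w

decT : (b : Bool) → Maybe (T b)
decT true  = just tt
decT false = nothing

∧-swapT : (a b : Bool) → T (a ∧ b) → T (b ∧ a)
∧-swapT true  true  t = t
∧-swapT true  false ()
∧-swapT false b     ()

module Alg (N : ℕ) where

  Perm : Set
  Perm = Vec (Fin N) N

  compP : Perm → Perm → Perm
  compP p q = tabulate (λ x → lookup p (lookup q x))

  isId : Perm → Bool
  isId p = allF N (λ x → eqF (lookup p x) x)

  record G : Set where
    constructor mkG
    field
      fwd : Perm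
      bwd : Perm
      ok  : T (isId (compP fwd bwd) ∧ isId (compP bwd fwd))
  open G public

  inv : G → G
  inv (mkG f b p) = mkG b f (∧-swapT (isId (compP f b)) (isId (compP b f)) p)

  isMul : G → G → G → Bool
  isMul k g h = allF N (λ x → eqF (lookup (fwd k) x) (lookup (fwd g) (lookup (fwd h) x)))

  isE : G → Bool
  isE g = isId (fwd g)

  -- enumeration of G (each element exactly once)
  allVecs : (m : ℕ) → List (Vec (Fin N) m)
  allVecs zero    = [] L.∷ L.[]
  allVecs (suc m) = L.concatMap (λ i → L.map (i ∷_) (allVecs m)) (L.allFin N)

  toG : Perm → Perm → Maybe G
  toG v w with decT (isId (compP v w) ∧ isId (compP w v))
  ... | just p  = just (mkG v w p)
  ... | nothing = nothing

  allG : List G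
  allG = L.concatMap (λ v → L.mapMaybe (toG v) (allVecs N)) (allVecs N)

  sumG : (G → Bool) → Bool
  sumG f = L.foldr _xor_ false (L.map f allG)

  -- R = k[G]: functions on G
  R : Set
  R = G → Bool

  -- generators of W: the constant 1 (nothing) and g ↦ g_{u,v} = [g v = u]
  Gen : Set
  Gen = Maybe (Fin N × Fin N)

  genVal : Gen → R
  genVal nothing        g = true
  genVal (just (u , v)) g = eqF (lookup (fwd g) v) u

  prodGen : {d : ℕ} → Vec Gen d → R
  prodGen []       g = true
  prodGen (x ∷ xs) g = genVal x g ∧ prodGen xs g

  InR : ℕ → R → Set
  InR d r = Σ (List (Vec Gen d)) λ ps → (g : G) → r g ≡ L.foldr _xor_ false (L.map (λ p → prodGen p g) ps)

  -- representations: μ(e_j) = Σ_i e_i ⊗ coeff i j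
  record Rep : Set where
    constructor mkRep
    field
      dim   : ℕ
      coeff : Fin dim → Fin dim → R
  open Rep public

  -- coassociativity and counitality of μ
  IsRep : Rep → Set
  IsRep V =
    ((i j : Fin (dim V)) (g h k : G) → T (isMul k g h) →
       coeff V i j k ≡ ΣF (dim V) (λ m → coeff V i m g ∧ coeff V m j h))
    × ((i j : Fin (dim V)) (g : G) → T (isE g) → coeff V i j g ≡ eqF i j)

  LevelLE : Rep → ℕ → Set
  LevelLE V l = (i j : Fin (dim V)) → InR l (coeff V i j)

  trivR : Rep
  trivR = mkRep 1 (λ _ _ _ → true)

  permR : Rep
  permR = mkRep N (λ i j g → eqF (lookup (fwd g) j) i)

  _⊕R_ : Rep → Rep → Rep
  V ⊕R W = mkRep (dim V + dim W) c
    where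
    c : Fin (dim V + dim W) → Fin (dim V + dim W) → R
    c i j with splitAt (dim V) i | splitAt (dim V) j
    ... | inj₁ i' | inj₁ j' = coeff V i' j'
    ... | inj₂ i' | inj₂ j' = coeff W i' j'
    ... | _       | _       = λ _ → false

  _⊗R_ : Rep → Rep → Rep
  V ⊗R W = mkRep (dim V * dim W) (λ i j g →
    coeff V (proj₁ (remQuot {dim V} (dim W) i)) (proj₁ (remQuot {dim V} (dim W) j)) g ∧
    coeff W (proj₂ (remQuot {dim V} (dim W) i)) (proj₂ (remQuot {dim V} (dim W) j)) g)

  dualR : Rep → Rep
  dualR V = mkRep (dim V) (λ i j g → coeff V j i (inv g))

  Mat : ℕ → ℕ → Set
  Mat d' d = Fin d' → Fin d → Bool

  apply : {d' d : ℕ} → Mat d' d → Vec Bool d → Vec Bool d'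
  apply {d'} {d} f x = tabulate (λ a → ΣF d (λ j → f a j ∧ lookup x j))

  Equivariant : (V W : Rep) → Mat (dim W) (dim V) → Set
  Equivariant V W f = (b : Fin (dim W)) (j : Fin (dim V)) (g : G) →
    ΣF (dim W) (λ a → coeff W b a g ∧ f a j) ≡ ΣF (dim V) (λ i → f b i ∧ coeff V i j g)

  act : (V : Rep) → G → Vec Bool (dim V) → Vec Bool (dim V)
  act V g w = tabulate (λ i → ΣF (dim V) (λ j → coeff V i j g ∧ lookup w j))

  data Variance : Set where
    co contra : Variance

  _·v_ : Variance → Variance → Variance
  co     ·v s = s
  contra ·v co = contra
  contra ·v contra = co

  data CFun : Rep → Rep → Variance → Set where
    cEmpty : {V : Rep} (W : Rep) → IsRep W → LevelLE W 3 → CFun V W co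
    cZero  : {V : Rep} (W : Rep) → IsRep W → LevelLE W 3 → CFun V W co
    cFull  : {V : Rep} (W : Rep) → IsRep W → LevelLE W 3 → CFun V W co
    cConst : {V : Rep} → Bool → CFun V trivR co
    cLin   : {V : Rep} (W : Rep) → IsRep W → LevelLE W 3 →
             (f : Mat (dim W) (dim V)) → Equivariant V W f → CFun V W co
    cDual  : {V : Rep} → LevelLE (dualR V) 3 → CFun V (dualR V) contra
    cSum   : {V W W' : Rep} {s : Variance} → CFun V W s → CFun V W' s → CFun V (W ⊕R W') s
    cTen   : {V W W' : Rep} {s : Variance} (a b : ℕ) → a + b ≤ 3 →
             LevelLE W a → LevelLE W' b →
             CFun V W s → CFun V W' s → CFun V (W ⊗R W') s
    cComp  : {V W Z : Rep} {s t : Variance} → CFun V W s → CFun W Z t → CFun V Z (s ·v t)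

  sem : {V W : Rep} {s : Variance} → CFun V W s → Subset (dim V) → Subset (dim W)
  sem (cEmpty W _ _)     X w = ⊥
  sem (cZero W _ _)      X w = w ≡ 0ᵥ
  sem (cFull W _ _)      X w = ⊤
  sem (cConst c)         X w = w ≡ c ∷ []
  sem {V} (cLin W _ _ f _) X w = Σ (Vec Bool (dim V)) λ x → X x × apply f x ≡ w
  sem (cDual _)          X w = (x : Vec Bool _) → X x → dot w x ≡ true
  sem (cSum {W = W} F F') X w = sem F X (take (dim W) w) × sem F' X (drop (dim W) w)
  sem (cTen {W = W} {W' = W'} _ _ _ _ _ F F') X =
    AffSpan (λ w → Σ (Vec Bool (dim W)) λ y → Σ (Vec Bool (dim W')) λ y' →
               sem F X y × sem F' X y' × (y ⊗ᵥ y') ≡ w)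
  sem (cComp F F')       X = sem F' (sem F X)

  SGen : (V : Rep) → Subset (dim V) → Subset (dim V) → R → Set
  SGen V X1 X2 r =
    (Σ (Vec Bool (dim V)) λ f → Σ (Vec Bool (dim V)) λ w → Σ (Vec Bool (dim V)) λ v2 →
       X1 w × X2 v2 × ((x : Vec Bool (dim V)) → X2 x → dot f x ≡ dot f v2) ×
       ((g : G) → r g ≡ (dot f (act V g w) xor dot f v2)))
    ⊎ (((x : Vec Bool (dim V)) → ¬ X2 x) × Σ (Vec Bool (dim V)) X1 × ((g : G) → r g ≡ true))

  -- ((S))_3 : smallest subspace J ⊇ S with (J)_3 = J
  data InJ (V : Rep) (X1 X2 : Subset (dim V)) : R → Set where
    base : {r : R} → SGen V X1 X2 r → InJ V X1 X2 r
    zer  : InJ V X1 X2 (λ _ → false)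
    add  : {r s : R} → InJ V X1 X2 r → InJ V X1 X2 s → InJ V X1 X2 (λ g → r g xor s g)
    mul  : {r s : R} (e : ℕ) → e ≤ 3 → InJ V X1 X2 r → InR e r → InR (3 ∸ e) s →
           InJ V X1 X2 (λ g → r g ∧ s g)
    ext  : {r r' : R} → InJ V X1 X2 r → ((g : G) → r g ≡ r' g) → InJ V X1 X2 r'

  -- linear functionals on R (restricted to R_3) given by coefficient functions
  ev : R → R → Bool
  ev φ r = sumG (λ g → φ g ∧ r g)

  Hom3 : (V : Rep) → Subset (dim V) → Subset (dim V) → R → Set
  Hom3 V X1 X2 φ = (r : R) → InJ V X1 X2 r → ev φ r ≡ false

  -- r ↦ (ψ ⊗ φ) Δ(r)
  comp3 : R → R → R → Bool
  comp3 ψ φ r = sumG (λ g → sumG (λ h → sumG (λ k → isMul k g h ∧ ψ g ∧ φ h ∧ r k)))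

  ε3 : R → Bool
  ε3 r = sumG (λ g → isE g ∧ r g)

  IsoC3 : (V : Rep) → Subset (dim V) → Subset (dim V) → Set
  IsoC3 V X1 X2 = Σ R λ φ → Σ R λ ψ → Hom3 V X1 X2 φ × Hom3 V X2 X1 ψ ×
    ((r : R) → InR 3 r → comp3 ψ φ r ≡ ε3 r) × ((r : R) → InR 3 r → comp3 φ ψ r ≡ ε3 r)

  Vrep : Rep
  Vrep = (((permR ⊗R permR) ⊕R permR) ⊕R permR) ⊕R trivR

module CFIV (n : ℕ) (adj : Fin n → Fin n → Bool) where

  count : {m : ℕ} → Vec Bool m → ℕ
  count []           = 0
  count (true ∷ xs)  = suc (count xs)
  count (false ∷ xs) = count xs

  -- Y ⊆ E(x), edges of E(x) identified with the other endpoint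
  subNbr : Fin n → Vec Bool n → Bool
  subNbr x Y = allF n (λ y → not (lookup Y y) ∨ adj x y)

  -- c x Y = c_{x,Y};  a x y = a_{x,{x,y}};  b x y = b_{x,{x,y}}
  data Vtx : Set where
    c : (x : Fin n) (Y : Vec Bool n) → T (subNbr x Y) → T (not (oddB (count Y))) → Vtx
    a : (x y : Fin n) → T (adj x y) → Vtx
    b : (x y : Fin n) → T (adj x y) → Vtx

  isX1 : Vtx → Bool
  isX1 (c _ _ _ _) = true
  isX1 (a _ _ _)   = false
  isX1 (b _ _ _)   = false

module CFI (n : ℕ) (adj : Fin n → Fin n → Bool) (x~ y~ : Fin n) where
  open CFIV n adj

  tilde : Fin n → Fin n → Bool
  tilde x y = (eqF x x~ ∧ eqF y y~) ∨ (eqF x y~ ∧ eqF y x~)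

  E0 : Vtx → Vtx → Bool
  E0 (a x y _) (c x' Y _ _) = eqF x x' ∧ lookup Y y
  E0 (b x y _) (c x' Y _ _) = eqF x x' ∧ not (lookup Y y)
  E0 (a x y _) (a x' y' _)  = eqF x' y ∧ eqF y' x
  E0 (b x y _) (b x' y' _)  = eqF x' y ∧ eqF y' x
  E0 _ _ = false

  E0' : Vtx → Vtx → Bool
  E0' (a x y _) (c x' Y _ _) = eqF x x' ∧ lookup Y y
  E0' (b x y _) (c x' Y _ _) = eqF x x' ∧ not (lookup Y y)
  E0' (a x y _) (a x' y' _)  = eqF x' y ∧ eqF y' x ∧ not (tilde x y)
  E0' (b x y _) (b x' y' _)  = eqF x' y ∧ eqF y' x ∧ not (tilde x y)
  E0' (a x y _) (b x' y' _)  = eqF x' y ∧ eqF y' x ∧ tilde x y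
  E0' _ _ = false

  Eg : Vtx → Vtx → Bool
  Eg u v = E0 u v ∨ E0 v u

  Eg' : Vtx → Vtx → Bool
  Eg' u v = E0' u v ∨ E0' v u

  ColIso : Set
  ColIso = Σ (Vtx ↔ Vtx) λ σ →
    ((u : Vtx) → isX1 (Inverse.to σ u) ≡ isX1 u) ×
    ((u v : Vtx) → Eg' (Inverse.to σ u) (Inverse.to σ v) ≡ Eg u v)

module CFIA (n : ℕ) (adj : Fin n → Fin n → Bool) (x~ y~ : Fin n)
            (N : ℕ) (π : CFIV.Vtx n adj ↔ Fin N) where
  open CFIV n adj
  open CFI n adj x~ y~

  lab : Fin N → Vtx
  lab = Inverse.from π

  -- A_Γ = (Σ_{(u,v)∈R} u⊗v, Σ_{X1} u, Σ_{X2} u, 1)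
  encode : (Vtx → Vtx → Bool) → Vec Bool (Alg.Rep.dim (Alg.Vrep N))
  encode E =
    ((tabulate (λ k → E (lab (proj₁ (remQuot {N} N k))) (lab (proj₂ (remQuot {N} N k))))
      ++ tabulate (λ i → isX1 (lab i)))
      ++ tabulate (λ i → not (isX1 (lab i))))
      ++ (true ∷ [])

  AΓ : Vec Bool (Alg.Rep.dim (Alg.Vrep N))
  AΓ = encode Eg

  AΓ' : Vec Bool (Alg.Rep.dim (Alg.Vrep N))
  AΓ' = encode Eg'

{-# OPTIONS --safe #-}
module Submission where

-- Let S(E) be the space of f : X(Q) → 𝔽₂ vanishing on X₁ with A_E f = f.  Every vertex of X₂ has exactly one
-- neighbour in X₂, so f is constant along the X₂-edges and sums to 0 over the neighbours of each c_{x,Y}.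
-- Comparing different Y shows that δ(x,e) = f(a_{x,e}) + f(b_{x,e}) depends on x only, hence is constant on the
-- components of Q.  A parity count forces δ = 0 at the twisted edge for Γ'(Q), whereas the indicator f₀ of the
-- vertices a_{x,e} lies in S(Γ) and has δ = 1.  So S(Γ) = S(Γ') ⊕ ⟨f₀⟩.
--
-- The set S(E) × {1} is the value at A_Γ of a 3-constructible functor: it is the dual of
-- ((A + I) U + diag(1_{X₁}) U) × {1}, a contraction of tensor products of level 2 + 1.
--
-- A morphism ψ : A_Γ' → A_Γ acts on U, and its transpose maps S(Γ) to S(Γ').  If ψ is invertible this map is
-- injective, so f₀ returns to itself under iteration and would lie in S(Γ').

open import Defs
open import Data.Bool using (Bool; true; false; not; T; _∧_; _∨_; _xor_)
import Data.Bool as Bool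
open import Data.Bool.Properties using (T-irrelevant; T-not-≡; T-∧; T-≡; T?; xor-assoc; xor-comm; xor-identityʳ; xor-same; ∧-assoc; ∧-comm; ∧-distribʳ-xor; ∧-distribˡ-xor; ∧-identityʳ; ∧-zeroʳ; ∨-comm; ∨-idem; ∨-identityʳ)
open import Data.Empty using (⊥-elim)
open import Data.Fin using (Fin; _↑ʳ_; _↑ˡ_; _≟_; combine; join; remQuot; splitAt; suc; toℕ; zero)
open import Data.Fin.Properties using (all?; combine-injective; combine-remQuot; join-splitAt; pigeonhole; remQuot-combine; splitAt-join; splitAt-↑ʳ; splitAt-↑ˡ; splitAt⁻¹-↑ʳ; splitAt⁻¹-↑ˡ; suc-injective; ↑ʳ-injective; ↑ˡ-injective)
open import Data.List as L using (List)
open import Data.List.Relation.Unary.All as All using (All)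
open import Data.Maybe using (Maybe; just; nothing; maybe)
open import Data.Maybe.Properties using (just-injective)
open import Data.Nat using (ℕ; zero; suc; _+_; _*_; _^_; _<_; z≤n; s≤s)
open import Data.Nat.Properties using (≤-refl; n<1+n; 1+n≢n)
open import Data.Product using (Σ; _×_; _,_; proj₁; proj₂)
open import Data.Sum as Sum using (_⊎_; inj₁; inj₂; [_,_]′)
open import Data.Unit using (⊤; tt)
open import Data.Vec using (Vec; []; _++_; _∷_; drop; lookup; map; replicate; tabulate; take)
open import Data.Vec.Properties using (drop-zipWith; lookup-++ʳ; lookup-++ˡ; lookup-replicate; lookup-zipWith; lookup∘tabulate; tabulate-cong; tabulate∘lookup; take-zipWith; zipWith-assoc; zipWith-comm; zipWith-identityˡ; ∷-injectiveʳ; ≡-dec)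
open import Function using (_∘_; id; Equivalence; Injective)
open import Function.Bundles using (_↔_; Inverse)
open import Relation.Binary.PropositionalEquality using (_≡_; _≢_; refl; sym; trans; cong; cong₂; subst; module ≡-Reasoning)
open import Relation.Nullary using (¬_; Dec; yes; no; contradiction)
open import Relation.Nullary.Decidable using (_×-dec_)

-- The level bound 3 is used up exactly, and in the same way twice. In the functor the matrix A
-- costs level 2 and the vectors of U cost level 1. For morphisms, a relation "coordinate of gA′
-- equals coordinate of A" lies in level 2, which leaves room for one matrix coefficient of g as a
-- factor; that factor is what turns the relations into an intertwining of the two adjacency
-- matrices on U.
--
-- Both graphs are treated as one linear system with a parameter τ that marks the twisted edges. A
-- twist exchanges the two vertices a and b at one end of an edge, so a solution with δ = 0 there
-- cannot see it. This gives S(Γ′) inside S(Γ) once the parity count has shown δ = 0 for Γ′.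
--
-- The second claim is proved separately from the dimensions: deducing it from them would require
-- the action of a constructible functor on morphisms, whereas the argument here needs only the
-- action of ψ on U. As S(Γ′) is a subset of S(Γ), the injective map from S(Γ) to S(Γ′) can be
-- iterated, and finiteness replaces a comparison of dimensions.

∧-swap : ∀ p q r → p ∧ (q ∧ r) ≡ q ∧ (p ∧ r)
∧-swap true  q r = refl
∧-swap false q r = sym (∧-zeroʳ q)

xor-interchange : ∀ p q r s → (p xor q) xor (r xor s) ≡ (p xor r) xor (q xor s)
xor-interchange p q r s = trans (xor-assoc p q (r xor s)) (trans (cong (p xor_) swap) (sym (xor-assoc p r (q xor s))))
  where
  swap : q xor (r xor s) ≡ r xor (q xor s)
  swap = trans (sym (xor-assoc q r s)) (trans (cong (_xor s) (xor-comm q r)) (xor-assoc r q s))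

xor-cancelˡ : ∀ p q → p xor (p xor q) ≡ q
xor-cancelˡ p q = trans (sym (xor-assoc p p q)) (cong (_xor q) (xor-same p))

xor≡false⇒≡ : ∀ p q → p xor q ≡ false → p ≡ q
xor≡false⇒≡ false false _ = refl
xor≡false⇒≡ true  true  _ = refl

≡⇒xor≡false : ∀ {p q} → p ≡ q → p xor q ≡ false
≡⇒xor≡false {p} refl = xor-same p

true≢false : true ≢ false
true≢false ()

-- Equality tests and finite sums over 𝔽₂

eqF-refl : ∀ {n} (i : Fin n) → eqF i i ≡ true
eqF-refl i with i ≟ i
... | yes _  = refl
... | no i≢i = contradiction refl i≢i

≢⇒eqF : ∀ {n} {i j : Fin n} → i ≢ j → eqF i j ≡ false
≢⇒eqF {i = i} {j} i≢j with i ≟ j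
... | yes i≡j = contradiction i≡j i≢j
... | no _    = refl

eqF⇒≡ : ∀ {n} {i j : Fin n} → eqF i j ≡ true → i ≡ j
eqF⇒≡ {i = i} {j} e with i ≟ j
... | yes p = p

eqF-⇔ : ∀ {m n} {i j : Fin m} {k l : Fin n} → (i ≡ j → k ≡ l) → (k ≡ l → i ≡ j) → eqF i j ≡ eqF k l
eqF-⇔ {i = i} {j} {k} {l} to from with i ≟ j | k ≟ l
... | yes _ | yes _ = refl
... | no _  | no _  = refl
... | yes p | no ¬q = contradiction (to p) ¬q
... | no ¬p | yes q = contradiction (from q) ¬p

eqF-sym : ∀ {n} (i j : Fin n) → eqF i j ≡ eqF j i
eqF-sym i j = eqF-⇔ sym sym

eqF-injective : ∀ {m n} {f : Fin m → Fin n} → Injective _≡_ _≡_ f → ∀ i j → eqF (f i) (f j) ≡ eqF i j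
eqF-injective {f = f} inj i j = eqF-⇔ inj (cong f)

eqF-combine : ∀ {m n} (i k : Fin m) (j l : Fin n) → eqF (combine i j) (combine k l) ≡ eqF i k ∧ eqF j l
eqF-combine i k j l with i ≟ k | j ≟ l
... | yes refl | yes refl = eqF-refl (combine i j)
... | yes _    | no j≢l   = ≢⇒eqF (j≢l ∘ proj₂ ∘ combine-injective i j k l)
... | no i≢k   | _        = ≢⇒eqF (i≢k ∘ proj₁ ∘ combine-injective i j k l)

ΣF-cong : ∀ n {f g : Fin n → Bool} → (∀ i → f i ≡ g i) → ΣF n f ≡ ΣF n g
ΣF-cong zero    e = refl
ΣF-cong (suc n) e = cong₂ _xor_ (e zero) (ΣF-cong n (e ∘ suc))

ΣF-false : ∀ n {f : Fin n → Bool} → (∀ i → f i ≡ false) → ΣF n f ≡ false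
ΣF-false zero    e = refl
ΣF-false (suc n) e rewrite e zero = ΣF-false n (e ∘ suc)

ΣF-xor : ∀ n (f g : Fin n → Bool) → ΣF n (λ i → f i xor g i) ≡ ΣF n f xor ΣF n g
ΣF-xor zero    f g = refl
ΣF-xor (suc n) f g =
  trans (cong ((f zero xor g zero) xor_) (ΣF-xor n (f ∘ suc) (g ∘ suc)))
        (xor-interchange (f zero) (g zero) _ _)

∧-ΣF : ∀ n p (f : Fin n → Bool) → p ∧ ΣF n f ≡ ΣF n (λ i → p ∧ f i)
∧-ΣF n true  f = refl
∧-ΣF n false f = sym (ΣF-false n (λ _ → refl))

ΣF-∧ : ∀ n (f : Fin n → Bool) p → ΣF n f ∧ p ≡ ΣF n (λ i → f i ∧ p)
ΣF-∧ n f p = trans (∧-comm (ΣF n f) p) (trans (∧-ΣF n p f) (ΣF-cong n (λ i → ∧-comm p (f i))))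

ΣF-swap : ∀ m n (f : Fin m → Fin n → Bool) → ΣF m (λ i → ΣF n (f i)) ≡ ΣF n (λ j → ΣF m (λ i → f i j))
ΣF-swap zero    n f = sym (ΣF-false n (λ _ → refl))
ΣF-swap (suc m) n f =
  trans (cong (ΣF n (f zero) xor_) (ΣF-swap m n (f ∘ suc)))
        (sym (ΣF-xor n (f zero) (λ j → ΣF m (λ i → f (suc i) j))))

ΣF-single : ∀ n (f : Fin n → Bool) k → (∀ i → i ≢ k → f i ≡ false) → ΣF n f ≡ f k
ΣF-single (suc n) f zero    e =
  trans (cong (f zero xor_) (ΣF-false n (λ i → e (suc i) (λ ())))) (xor-identityʳ (f zero))
ΣF-single (suc n) f (suc k) e rewrite e zero (λ ()) =
  ΣF-single n (f ∘ suc) k (λ i i≢k → e (suc i) (i≢k ∘ suc-injective))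

ΣF-eqF : ∀ n (k : Fin n) (f : Fin n → Bool) → ΣF n (λ i → eqF i k ∧ f i) ≡ f k
ΣF-eqF n k f = trans (ΣF-single n _ k (λ i i≢k → cong (_∧ f i) (≢⇒eqF i≢k))) (cong (_∧ f k) (eqF-refl k))

ΣF-eqF′ : ∀ n (k : Fin n) (f : Fin n → Bool) → ΣF n (λ i → eqF k i ∧ f i) ≡ f k
ΣF-eqF′ n k f = trans (ΣF-cong n (λ i → cong (_∧ f i) (eqF-sym k i))) (ΣF-eqF n k f)

-- Expanding f (σ j) as the sum over i of [σ j = i] f i and exchanging the sums leaves, for each i,
-- the single term j = τ i.
ΣF-reindex : ∀ n (σ τ : Fin n → Fin n) → (∀ i → σ (τ i) ≡ i) → (∀ i → τ (σ i) ≡ i) →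
  (f : Fin n → Bool) → ΣF n (f ∘ σ) ≡ ΣF n f
ΣF-reindex n σ τ στ τσ f = begin
  ΣF n (f ∘ σ)                                      ≡⟨ ΣF-cong n (λ j → sym (ΣF-eqF′ n (σ j) f)) ⟩
  ΣF n (λ j → ΣF n (λ i → eqF (σ j) i ∧ f i))       ≡⟨ ΣF-swap n n _ ⟩
  ΣF n (λ i → ΣF n (λ j → eqF (σ j) i ∧ f i))       ≡⟨ ΣF-cong n (λ i → trans (ΣF-cong n (λ j → cong (_∧ f i) (flip i j))) (ΣF-eqF n (τ i) (λ _ → f i))) ⟩
  ΣF n f ∎
  where
  open ≡-Reasoning
  flip : ∀ i j → eqF (σ j) i ≡ eqF j (τ i)
  flip i j = eqF-⇔ (λ e → trans (sym (τσ j)) (cong τ e)) (λ e → trans (cong σ e) (στ i))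

ΣF-+ : ∀ m n (f : Fin (m + n) → Bool) → ΣF (m + n) f ≡ ΣF m (λ i → f (i ↑ˡ n)) xor ΣF n (λ j → f (m ↑ʳ j))
ΣF-+ zero    n f = refl
ΣF-+ (suc m) n f = trans (cong (f zero xor_) (ΣF-+ m n (f ∘ suc))) (sym (xor-assoc (f zero) _ _))

ΣF-* : ∀ m n (f : Fin (m * n) → Bool) → ΣF (m * n) f ≡ ΣF m (λ i → ΣF n (λ j → f (combine i j)))
ΣF-* zero    n f = refl
ΣF-* (suc m) n f = trans (ΣF-+ n (m * n) f) (cong (ΣF n (λ j → f (j ↑ˡ (m * n))) xor_) (ΣF-* m n (λ k → f (n ↑ʳ k))))

-- In characteristic 2 the entries at (i, j) and (j, i) cancel. The induction peels off the first
-- row and the first column, whose sums agree.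
ΣΣ-symmetric : ∀ n (f : Fin n → Fin n → Bool) → (∀ i j → f i j ≡ f j i) → (∀ i → f i i ≡ false) →
  ΣF n (λ i → ΣF n (f i)) ≡ false
ΣΣ-symmetric zero    f s d = refl
ΣΣ-symmetric (suc n) f s d = begin
  (f zero zero xor row) xor ΣF n (λ i → f (suc i) zero xor ΣF n (λ j → f (suc i) (suc j)))
    ≡⟨ cong₂ _xor_ (cong (_xor row) (d zero)) (ΣF-xor n (λ i → f (suc i) zero) (λ i → ΣF n (λ j → f (suc i) (suc j)))) ⟩
  row xor (ΣF n (λ i → f (suc i) zero) xor ΣF n (λ i → ΣF n (λ j → f (suc i) (suc j))))
    ≡⟨ cong (row xor_) (cong₂ _xor_ (ΣF-cong n (λ i → s (suc i) zero)) (ΣΣ-symmetric n _ (λ i j → s (suc i) (suc j)) (d ∘ suc))) ⟩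
  row xor (row xor false)
    ≡⟨ xor-cancelˡ row false ⟩
  false ∎
  where
  open ≡-Reasoning
  row = ΣF n (λ j → f zero (suc j))

true⊎allFalse : ∀ {n} (f : Fin n → Bool) → (Σ (Fin n) λ i → f i ≡ true) ⊎ (∀ i → f i ≡ false)
true⊎allFalse {zero}  f = inj₂ λ ()
true⊎allFalse {suc n} f with f zero in e | true⊎allFalse (f ∘ suc)
... | true  | _            = inj₁ (zero , e)
... | false | inj₁ (i , p) = inj₁ (suc i , p)
... | false | inj₂ q       = inj₂ λ { zero → e ; (suc i) → q i }

-- Vectors over 𝔽₂ and bases of subspaces

lookup-ext : ∀ {A : Set} {n} {u v : Vec A n} → (∀ i → lookup u i ≡ lookup v i) → u ≡ v
lookup-ext {u = u} {v} e = trans (sym (tabulate∘lookup u)) (trans (tabulate-cong e) (tabulate∘lookup v))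

lookup-+ᵥ : ∀ {d} (u v : Vec Bool d) i → lookup (u +ᵥ v) i ≡ lookup u i xor lookup v i
lookup-+ᵥ u v i = lookup-zipWith _xor_ i u v

+ᵥ-same : ∀ {d} (u : Vec Bool d) → u +ᵥ u ≡ 0ᵥ
+ᵥ-same []      = refl
+ᵥ-same (x ∷ u) = cong₂ _∷_ (xor-same x) (+ᵥ-same u)

+ᵥ-assoc : ∀ {d} (u v w : Vec Bool d) → (u +ᵥ v) +ᵥ w ≡ u +ᵥ (v +ᵥ w)
+ᵥ-assoc = zipWith-assoc xor-assoc

+ᵥ-comm : ∀ {d} (u v : Vec Bool d) → u +ᵥ v ≡ v +ᵥ u
+ᵥ-comm = zipWith-comm xor-comm

+ᵥ-identityˡ : ∀ {d} (u : Vec Bool d) → 0ᵥ +ᵥ u ≡ u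
+ᵥ-identityˡ = zipWith-identityˡ (λ _ → refl)

+ᵥ-cancelˡ : ∀ {d} (u v : Vec Bool d) → u +ᵥ (u +ᵥ v) ≡ v
+ᵥ-cancelˡ u v = trans (sym (+ᵥ-assoc u u v)) (trans (cong (_+ᵥ v) (+ᵥ-same u)) (+ᵥ-identityˡ v))

+ᵥ-cancelʳ : ∀ {d} (u v : Vec Bool d) → (u +ᵥ v) +ᵥ v ≡ u
+ᵥ-cancelʳ u v = trans (+ᵥ-comm (u +ᵥ v) v) (trans (cong (v +ᵥ_) (+ᵥ-comm u v)) (+ᵥ-cancelˡ v u))

record Basis {d : ℕ} (P : Subset d) (m : ℕ) : Set where
  constructor mkBasis
  field
    vectors     : Vec (Vec Bool d) m
    independent : LinIndep vectors
    sound       : ∀ z → P z → InSpan vectors z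
    complete    : ∀ z → InSpan vectors z → P z
open Basis

-- The last three hypotheses say that `P` is the union of `P′` and its translate by `u`. This one
-- step serves both the construction of bases in `subspace-basis` and the adjunction of `f₀` to a
-- basis for Γ′.
basis-extend : ∀ {d m} {P P′ : Subset d} → Basis P′ m → (u : Vec Bool d) → ¬ P′ u →
  (∀ z → P z → P′ z ⊎ P′ (z +ᵥ u)) → (∀ z → P′ z → P z) → (∀ z → P′ z → P (u +ᵥ z)) →
  Basis P (suc m)
basis-extend {d} {m} {P} {P′} B u u∉P′ split sub shift = mkBasis (u ∷ vectors B) indep snd′ cmp
  where
  indep : LinIndep (u ∷ vectors B)
  indep (false ∷ c) e = cong (false ∷_) (independent B c (trans (sym (+ᵥ-identityˡ _)) e))
  indep (true ∷ c)  e = ⊥-elim (u∉P′ (complete B u (c , trans (sym (+ᵥ-cancelˡ u _)) (trans (cong (u +ᵥ_) e) (trans (+ᵥ-comm u 0ᵥ) (+ᵥ-identityˡ u))))))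
  snd′ : ∀ z → P z → InSpan (u ∷ vectors B) z
  snd′ z Pz with split z Pz
  ... | inj₁ p = let (c , e) = sound B z p in false ∷ c , trans (+ᵥ-identityˡ _) e
  ... | inj₂ p = let (c , e) = sound B (z +ᵥ u) p in
                 true ∷ c , trans (cong (u +ᵥ_) (trans e (+ᵥ-comm z u))) (+ᵥ-cancelˡ u z)
  cmp : ∀ z → InSpan (u ∷ vectors B) z → P z
  cmp z (false ∷ c , e) = sub z (complete B z (c , trans (sym (+ᵥ-identityˡ _)) e))
  cmp z (true ∷ c , e)  = subst P e (shift _ (complete B _ (c , refl)))

lincomb-map-false : ∀ {d m} (c : Vec Bool m) (bs : Vec (Vec Bool d) m) →
  lincomb c (map (false ∷_) bs) ≡ false ∷ lincomb c bs
lincomb-map-false []          []       = refl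
lincomb-map-false (true ∷ c)  (b ∷ bs) = cong ((false ∷ b) +ᵥ_) (lincomb-map-false c bs)
lincomb-map-false (false ∷ c) (b ∷ bs) = cong (0ᵥ +ᵥ_) (lincomb-map-false c bs)

basis-false∷ : ∀ {d m} {P : Subset d} → Basis P m →
  Basis (λ z → Σ (Vec Bool d) λ w → P w × false ∷ w ≡ z) m
basis-false∷ {d} {m} {P} B = mkBasis (map (false ∷_) (vectors B)) indep snd′ cmp
  where
  indep : LinIndep (map (false ∷_) (vectors B))
  indep c e = independent B c (∷-injectiveʳ (trans (sym (lincomb-map-false c (vectors B))) e))
  snd′ : ∀ z → _ → InSpan (map (false ∷_) (vectors B)) z
  snd′ z (w , p , refl) = let (c , e) = sound B w p in c , trans (lincomb-map-false c _) (cong (false ∷_) e)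
  cmp : ∀ z → InSpan (map (false ∷_) (vectors B)) z → _
  cmp z (c , e) = lincomb c (vectors B) , complete B _ (c , refl) , trans (sym (lincomb-map-false c _)) e

search : ∀ {d} {P : Subset d} → (∀ z → Dec (P z)) → Dec (Σ (Vec Bool d) P)
search {zero} P? with P? []
... | yes p = yes ([] , p)
... | no ¬p = no λ { ([] , p) → ¬p p }
search {suc d} P? with search (P? ∘ (true ∷_)) | search (P? ∘ (false ∷_))
... | yes (w , p) | _           = yes (true ∷ w , p)
... | no _        | yes (w , p) = yes (false ∷ w , p)
... | no ¬p       | no ¬q       = no λ { (true ∷ w , p) → ¬p (w , p) ; (false ∷ w , p) → ¬q (w , p) }

basis-resp : ∀ {d m} {P Q : Subset d} → (∀ z → P z → Q z) → (∀ z → Q z → P z) → Basis P m → Basis Q m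
basis-resp pq qp B = mkBasis (vectors B) (independent B) (λ z → sound B z ∘ qp z) (λ z → pq z ∘ complete B z)

-- Elimination on the first coordinate: the vectors starting with `false` are handled by induction,
-- and one further vector starting with `true`, if the search finds any, is enough because two of
-- them differ by a vector starting with `false`.
subspace-basis : ∀ d (P : Subset d) → (∀ z → Dec (P z)) → P 0ᵥ → (∀ u v → P u → P v → P (u +ᵥ v)) →
  Σ ℕ (Basis P)
subspace-basis zero P P? P0 P+ =
  0 , mkBasis [] (λ { [] _ → refl }) (λ { [] _ → [] , refl }) (λ { [] _ → P0 })
subspace-basis (suc d) P P? P0 P+
  with subspace-basis d (P ∘ (false ∷_)) (P? ∘ (false ∷_)) P0 (λ u v → P+ (false ∷ u) (false ∷ v))
     | search (P? ∘ (true ∷_))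
... | m , B | yes (w , Pw) = suc m , basis-extend (basis-false∷ B) (true ∷ w) (λ { (_ , _ , ()) })
        (λ { (false ∷ z) p → inj₁ (z , p , refl)
           ; (true ∷ z)  p → inj₂ (z +ᵥ w , P+ (true ∷ z) (true ∷ w) p Pw , refl) })
        (λ { _ (z , p , refl) → p })
        (λ { _ (z , p , refl) → P+ (true ∷ w) (false ∷ z) Pw p })
... | m , B | no ¬w = m , basis-resp (λ { _ (z , p , refl) → p })
        (λ { (false ∷ z) p → z , p , refl ; (true ∷ z) p → ⊥-elim (¬w (z , p)) }) (basis-false∷ B)

basis⇒HasDim : ∀ {d m} {X : Subset d} (v : Vec Bool d) → Basis (λ z → X (z +ᵥ v)) m → HasDim X (just m)
basis⇒HasDim {X = X} v B = v , vectors B , independent B ,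
  λ w → (λ Xw → sound B (w +ᵥ v) (subst X (sym (+ᵥ-cancelʳ w v)) Xw)) ,
        (λ s → subst X (+ᵥ-cancelʳ w v) (complete B (w +ᵥ v) s))

-- Sums over lists

sumL : ∀ {A : Set} → (A → Bool) → List A → Bool
sumL f xs = L.foldr _xor_ false (L.map f xs)

sumL-cong : ∀ {A : Set} {f g : A → Bool} (xs : List A) → (∀ x → f x ≡ g x) → sumL f xs ≡ sumL g xs
sumL-cong L.[]       e = refl
sumL-cong (x L.∷ xs) e = cong₂ _xor_ (e x) (sumL-cong xs e)

sumL-false : ∀ {A : Set} {f : A → Bool} (xs : List A) → (∀ x → f x ≡ false) → sumL f xs ≡ false
sumL-false L.[]       e = refl
sumL-false (x L.∷ xs) e rewrite e x = sumL-false xs e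

sumL-xor : ∀ {A : Set} (f g : A → Bool) (xs : List A) → sumL (λ x → f x xor g x) xs ≡ sumL f xs xor sumL g xs
sumL-xor f g L.[]       = refl
sumL-xor f g (x L.∷ xs) =
  trans (cong ((f x xor g x) xor_) (sumL-xor f g xs)) (xor-interchange (f x) (g x) _ _)

∧-sumL : ∀ {A : Set} p (f : A → Bool) (xs : List A) → p ∧ sumL f xs ≡ sumL (λ x → p ∧ f x) xs
∧-sumL true  f xs = refl
∧-sumL false f xs = sym (sumL-false xs (λ _ → refl))

sumL-++ : ∀ {A : Set} (f : A → Bool) (xs ys : List A) → sumL f (xs L.++ ys) ≡ sumL f xs xor sumL f ys
sumL-++ f L.[]       ys = refl
sumL-++ f (x L.∷ xs) ys = trans (cong (f x xor_) (sumL-++ f xs ys)) (sym (xor-assoc (f x) _ _))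

sumL-map : ∀ {A B : Set} (f : B → Bool) (h : A → B) (xs : List A) → sumL f (L.map h xs) ≡ sumL (f ∘ h) xs
sumL-map f h L.[]       = refl
sumL-map f h (x L.∷ xs) = cong (f (h x) xor_) (sumL-map f h xs)

sumL-concatMap : ∀ {A B : Set} (f : B → Bool) (h : A → List B) (xs : List A) →
  sumL f (L.concatMap h xs) ≡ sumL (λ x → sumL f (h x)) xs
sumL-concatMap f h L.[]       = refl
sumL-concatMap f h (x L.∷ xs) =
  trans (sumL-++ f (h x) (L.concatMap h xs)) (cong (sumL f (h x) xor_) (sumL-concatMap f h xs))

sumL-ΣF : ∀ {A : Set} n (f : A → Fin n → Bool) (xs : List A) →
  sumL (λ x → ΣF n (f x)) xs ≡ ΣF n (λ i → sumL (λ x → f x i) xs)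
sumL-ΣF n f L.[]       = sym (ΣF-false n (λ _ → refl))
sumL-ΣF n f (x L.∷ xs) =
  trans (cong (ΣF n (f x) xor_) (sumL-ΣF n f xs)) (sym (ΣF-xor n (f x) (λ i → sumL (λ y → f y i) xs)))

sumL-swap : ∀ {A B : Set} (f : A → B → Bool) (xs : List A) (ys : List B) →
  sumL (λ x → sumL (f x) ys) xs ≡ sumL (λ y → sumL (λ x → f x y) xs) ys
sumL-swap f L.[]       ys = sym (sumL-false ys (λ _ → refl))
sumL-swap f (x L.∷ xs) ys =
  trans (cong (sumL (f x) ys xor_) (sumL-swap f xs ys)) (sym (sumL-xor (f x) (λ y → sumL (λ z → f z y) xs) ys))

allF⇒∀ : ∀ n (f : Fin n → Bool) → T (allF n f) → ∀ i → f i ≡ true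
allF⇒∀ (suc n) f p zero    = Equivalence.to T-≡ (proj₁ (Equivalence.to T-∧ p))
allF⇒∀ (suc n) f p (suc i) = allF⇒∀ n (f ∘ suc) (proj₂ (Equivalence.to (T-∧ {f zero}) p)) i

∀⇒allF : ∀ n (f : Fin n → Bool) → (∀ i → f i ≡ true) → allF n f ≡ true
∀⇒allF zero    f e = refl
∀⇒allF (suc n) f e rewrite e zero = ∀⇒allF n (f ∘ suc) (e ∘ suc)

-- Permutation representations and the filtration R_d

module Representations (N : ℕ) where
  open Alg N

  isId⇒ : ∀ p q → T (isId (compP p q)) → ∀ i → lookup p (lookup q i) ≡ i
  isId⇒ p q t i = trans (sym (lookup∘tabulate _ i)) (eqF⇒≡ (allF⇒∀ N _ t i))

  fwd-bwd : ∀ g i → lookup (fwd g) (lookup (bwd g) i) ≡ i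
  fwd-bwd (mkG f b ok) = isId⇒ f b (proj₁ (Equivalence.to T-∧ ok))

  bwd-fwd : ∀ g i → lookup (bwd g) (lookup (fwd g) i) ≡ i
  bwd-fwd (mkG f b ok) = isId⇒ b f (proj₂ (Equivalence.to (T-∧ {isId (compP f b)}) ok))

  InR-cong : ∀ {d r s} → (∀ g → r g ≡ s g) → InR d r → InR d s
  InR-cong e (ps , q) = ps , λ g → trans (sym (e g)) (q g)

  InR-false : ∀ d → InR d (λ _ → false)
  InR-false d = L.[] , λ _ → refl

  -- W contains the constant 1, coded as the generator `nothing`, so 1 is a word of any length d.
  -- This is also why the R_d are nested, see `InR-weaken`.
  InR-true : ∀ d → InR d (λ _ → true)
  InR-true d = replicate d nothing L.∷ L.[] , λ g → sym (trans (xor-identityʳ _) (ones d g))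
    where
    ones : ∀ d g → prodGen (replicate d nothing) g ≡ true
    ones zero    g = refl
    ones (suc d) g = ones d g

  InR-const : ∀ d b → InR d (λ _ → b)
  InR-const d true  = InR-true d
  InR-const d false = InR-false d

  InR-xor : ∀ {d r s} → InR d r → InR d s → InR d (λ g → r g xor s g)
  InR-xor (ps , p) (qs , q) = ps L.++ qs , λ g → trans (cong₂ _xor_ (p g) (q g)) (sym (sumL-++ (λ x → prodGen x g) ps qs))

  InR-∧const : ∀ {d r} b → InR d r → InR d (λ g → r g ∧ b)
  InR-∧const true  p = InR-cong (λ g → sym (∧-identityʳ _)) p
  InR-∧const false p = InR-cong (λ g → sym (∧-zeroʳ _)) (InR-false _)

  InR-ΣF : ∀ {d} n {r : Fin n → R} → (∀ i → InR d (r i)) → InR d (λ g → ΣF n (λ i → r i g))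
  InR-ΣF zero    p = InR-false _
  InR-ΣF (suc n) p = InR-xor (p zero) (InR-ΣF n (p ∘ suc))

  prodGen-++ : ∀ {a b} (x : Vec Gen a) (y : Vec Gen b) g → prodGen (x ++ y) g ≡ prodGen x g ∧ prodGen y g
  prodGen-++ []      y g = refl
  prodGen-++ (u ∷ x) y g = trans (cong (genVal u g ∧_) (prodGen-++ x y g)) (sym (∧-assoc (genVal u g) _ _))

  InR-∧ : ∀ {a b r s} → InR a r → InR b s → InR (a + b) (λ g → r g ∧ s g)
  InR-∧ {r = r} {s} (ps , p) (qs , q) = L.concatMap (λ x → L.map (x ++_) qs) ps , λ g → begin
    r g ∧ s g
      ≡⟨ cong (_∧ s g) (p g) ⟩
    sumL (λ x → prodGen x g) ps ∧ s g
      ≡⟨ ∧-comm _ (s g) ⟩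
    s g ∧ sumL (λ x → prodGen x g) ps
      ≡⟨ ∧-sumL (s g) _ ps ⟩
    sumL (λ x → s g ∧ prodGen x g) ps
      ≡⟨ sumL-cong ps (λ x → trans (∧-comm (s g) _) (trans (cong (prodGen x g ∧_) (q g)) (∧-sumL (prodGen x g) _ qs))) ⟩
    sumL (λ x → sumL (λ y → prodGen x g ∧ prodGen y g) qs) ps
      ≡⟨ sumL-cong ps (λ x → sumL-cong qs (λ y → sym (prodGen-++ x y g))) ⟩
    sumL (λ x → sumL (λ y → prodGen (x ++ y) g) qs) ps
      ≡⟨ sumL-cong ps (λ x → sym (sumL-map (λ z → prodGen z g) (x ++_) qs)) ⟩
    sumL (λ x → sumL (λ z → prodGen z g) (L.map (x ++_) qs)) ps
      ≡⟨ sym (sumL-concatMap (λ z → prodGen z g) (λ x → L.map (x ++_) qs) ps) ⟩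
    _ ∎
    where open ≡-Reasoning

  InR-weaken : ∀ e {d r} → InR d r → InR (e + d) r
  InR-weaken e p = InR-∧ (InR-true e) p

  InR-gen : ∀ u v → InR 1 (λ g → eqF (lookup (fwd g) v) u)
  InR-gen u v = (just (u , v) ∷ []) L.∷ L.[] , λ g → sym (trans (xor-identityʳ _) (∧-identityʳ _))

  LevelLE-weaken : ∀ e {d V} → LevelLE V d → LevelLE V (e + d)
  LevelLE-weaken e l i j = InR-weaken e (l i j)

  LevelLE-permR : LevelLE permR 1
  LevelLE-permR i j = InR-gen i j

  LevelLE-trivR : ∀ d → LevelLE trivR d
  LevelLE-trivR d _ _ = InR-true d

  LevelLE-⊗ : ∀ {V W a b} → LevelLE V a → LevelLE W b → LevelLE (V ⊗R W) (a + b)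
  LevelLE-⊗ l l′ i j = InR-∧ (l _ _) (l′ _ _)

  LevelLE-⊕ : ∀ {V W d} → LevelLE V d → LevelLE W d → LevelLE (V ⊕R W) d
  LevelLE-⊕ {V} {W} l l′ i j with splitAt (dim V) i | splitAt (dim V) j
  ... | inj₁ i′ | inj₁ j′ = l i′ j′
  ... | inj₂ i′ | inj₂ j′ = l′ i′ j′
  ... | inj₁ _  | inj₂ _  = InR-false _
  ... | inj₂ _  | inj₁ _  = InR-false _

  -- The representations built below permute their basis. Recording the action on indices reduces
  -- coassociativity, counitality, the level of the dual and equivariance to facts about
  -- permutations.
  record PermAction (V : Rep) : Set where
    field
      _∙_     : G → Fin (dim V) → Fin (dim V)
      coeff-∙ : ∀ i j g → coeff V i j g ≡ eqF (g ∙ j) i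
      mul-∙   : ∀ k g h → T (isMul k g h) → ∀ i → k ∙ i ≡ g ∙ (h ∙ i)
      e-∙     : ∀ g → T (isE g) → ∀ i → g ∙ i ≡ i
      inv-∙   : ∀ g i → inv g ∙ (g ∙ i) ≡ i
      ∙-inv   : ∀ g i → g ∙ (inv g ∙ i) ≡ i

    ∙-injective : ∀ g → Injective _≡_ _≡_ (g ∙_)
    ∙-injective g {i} {j} e = trans (sym (inv-∙ g i)) (trans (cong (inv g ∙_) e) (inv-∙ g j))

    ∙-flip : ∀ g i j → eqF (g ∙ j) i ≡ eqF j (inv g ∙ i)
    ∙-flip g i j = trans (cong (eqF (g ∙ j)) (sym (∙-inv g i))) (eqF-injective (∙-injective g) j (inv g ∙ i))

    isRep : IsRep V
    isRep = (λ i j g h k t → begin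
        coeff V i j k                                         ≡⟨ coeff-∙ i j k ⟩
        eqF (k ∙ j) i                                         ≡⟨ cong (λ x → eqF x i) (mul-∙ k g h t j) ⟩
        eqF (g ∙ (h ∙ j)) i                                   ≡⟨ sym (ΣF-eqF′ (dim V) (h ∙ j) _) ⟩
        ΣF (dim V) (λ m → eqF (h ∙ j) m ∧ eqF (g ∙ m) i)      ≡⟨ ΣF-cong (dim V) (λ m → trans (∧-comm (eqF (h ∙ j) m) _) (sym (cong₂ _∧_ (coeff-∙ i m g) (coeff-∙ m j h)))) ⟩
        ΣF (dim V) (λ m → coeff V i m g ∧ coeff V m j h)      ∎)
      , λ i j g t → trans (coeff-∙ i j g) (trans (cong (λ x → eqF x i) (e-∙ g t j)) (eqF-sym j i))
      where open ≡-Reasoning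

    lookup-act : ∀ g w i → lookup (act V g w) i ≡ lookup w (inv g ∙ i)
    lookup-act g w i = trans (lookup∘tabulate _ i) (trans
      (ΣF-cong (dim V) (λ j → cong (_∧ lookup w j) (trans (coeff-∙ i j g) (∙-flip g i j))))
      (ΣF-eqF (dim V) (inv g ∙ i) (lookup w)))

    -- A permutation matrix equals its inverse transpose, so the dual has the same coefficient
    -- functions.
    LevelLE-dual : ∀ {d} → LevelLE V d → LevelLE (dualR V) d
    LevelLE-dual l i j = InR-cong
      (λ g → trans (coeff-∙ i j g) (trans (∙-flip g i j) (trans (eqF-sym j _) (sym (coeff-∙ j i (inv g)))))) (l i j)

  open PermAction

  -- The entries of `f` are constant on the orbits of pairs of indices. Hence both sides reduce to
  -- the entry in row `b` and column g ∙ j, the left one after moving g⁻¹ away from `b`.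
  equivariant : ∀ {V W} (A : PermAction V) (B : PermAction W) (f : Mat (dim W) (dim V)) →
    (∀ g b j → f (_∙_ B g b) (_∙_ A g j) ≡ f b j) → Equivariant V W f
  equivariant {V} {W} A B f f-inv b j g = begin
    ΣF (dim W) (λ a → coeff W b a g ∧ f a j)
      ≡⟨ ΣF-cong (dim W) (λ a → cong (_∧ f a j) (trans (coeff-∙ B b a g) (∙-flip B g b a))) ⟩
    ΣF (dim W) (λ a → eqF a (b′) ∧ f a j)
      ≡⟨ ΣF-eqF (dim W) b′ (λ a → f a j) ⟩
    f b′ j
      ≡⟨ sym (f-inv g b′ j) ⟩
    f (_∙_ B g b′) (_∙_ A g j)
      ≡⟨ cong (λ x → f x (_∙_ A g j)) (∙-inv B g b) ⟩
    f b (_∙_ A g j)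
      ≡⟨ sym (ΣF-eqF′ (dim V) (_∙_ A g j) (f b)) ⟩
    ΣF (dim V) (λ i → eqF (_∙_ A g j) i ∧ f b i)
      ≡⟨ ΣF-cong (dim V) (λ i → trans (∧-comm _ (f b i)) (cong (f b i ∧_) (sym (coeff-∙ A i j g)))) ⟩
    ΣF (dim V) (λ i → f b i ∧ coeff V i j g) ∎
    where
    open ≡-Reasoning
    b′ = _∙_ B (inv g) b

  permA : PermAction permR
  permA = record
    { _∙_     = λ g → lookup (fwd g)
    ; coeff-∙ = λ i j g → refl
    ; mul-∙   = λ k g h t i → eqF⇒≡ (allF⇒∀ N _ t i)
    ; e-∙     = λ g t i → eqF⇒≡ (allF⇒∀ N _ t i)
    ; inv-∙   = bwd-fwd
    ; ∙-inv   = fwd-bwd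
    }

  trivA : PermAction trivR
  trivA = record
    { _∙_     = λ g i → i
    ; coeff-∙ = λ { zero zero g → refl }
    ; mul-∙   = λ _ _ _ _ _ → refl
    ; e-∙     = λ _ _ _ → refl
    ; inv-∙   = λ _ _ → refl
    ; ∙-inv   = λ _ _ → refl
    }

  module _ {V W : Rep} (A : PermAction V) (B : PermAction W) where
    private
      m = dim V
      n = dim W
      fst : Fin (m * n) → Fin m
      fst i = proj₁ (remQuot {m} n i)
      snd : Fin (m * n) → Fin n
      snd i = proj₂ (remQuot {m} n i)

      infixr 7 _⊗∙_ _⊕∙_
      _⊗∙_ : G → Fin (m * n) → Fin (m * n)
      g ⊗∙ i = combine (_∙_ A g (fst i)) (_∙_ B g (snd i))

      _⊕∙_ : G → Fin (m + n) → Fin (m + n)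
      g ⊕∙ i = join m n (Sum.map (_∙_ A g) (_∙_ B g) (splitAt m i))

      coeff-⊗∙ : ∀ i j g → coeff (V ⊗R W) i j g ≡ eqF (g ⊗∙ j) i
      coeff-⊗∙ i j g = trans (cong₂ _∧_ (coeff-∙ A _ _ g) (coeff-∙ B _ _ g))
        (trans (sym (eqF-combine (_∙_ A g (fst j)) (fst i) (_∙_ B g (snd j)) (snd i))) (cong (eqF (g ⊗∙ j)) (combine-remQuot {m} n i)))

      coeff-⊕∙ : ∀ i j g → coeff (V ⊕R W) i j g ≡ eqF (g ⊕∙ j) i
      coeff-⊕∙ i j g with splitAt m i in ei | splitAt m j
      ... | inj₁ i′ | inj₁ j′ rewrite sym (splitAt⁻¹-↑ˡ {m} {n} ei) =
        trans (coeff-∙ A i′ j′ g) (sym (eqF-injective (↑ˡ-injective n _ _) (_∙_ A g j′) i′))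
      ... | inj₂ i′ | inj₂ j′ rewrite sym (splitAt⁻¹-↑ʳ {m} {n} ei) =
        trans (coeff-∙ B i′ j′ g) (sym (eqF-injective (↑ʳ-injective m _ _) (_∙_ B g j′) i′))
      -- The action keeps an index within its summand, so in an off-diagonal block the test compares
      -- indices of different summands.
      ... | inj₁ i′ | inj₂ j′ = sym (≢⇒eqF λ e → inj₁≢inj₂ (trans (sym ei) (trans (cong (splitAt m) (sym e)) (splitAt-↑ʳ m n _))))
        where
        inj₁≢inj₂ : ∀ {x : Fin m} {y : Fin n} → inj₁ x ≢ inj₂ y
        inj₁≢inj₂ ()
      ... | inj₂ i′ | inj₁ j′ = sym (≢⇒eqF λ e → inj₂≢inj₁ (trans (sym ei) (trans (cong (splitAt m) (sym e)) (splitAt-↑ˡ m _ n))))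
        where
        inj₂≢inj₁ : ∀ {x : Fin n} {y : Fin m} → inj₂ x ≢ inj₁ y
        inj₂≢inj₁ ()

      ⊗∙-∘ : ∀ g h i → g ⊗∙ (h ⊗∙ i) ≡ combine (_∙_ A g (_∙_ A h (fst i))) (_∙_ B g (_∙_ B h (snd i)))
      ⊗∙-∘ g h i = cong (λ p → combine (_∙_ A g (proj₁ p)) (_∙_ B g (proj₂ p))) (remQuot-combine _ _)

      ⊗∙-id : ∀ i {x y} → x ≡ fst i → y ≡ snd i → combine x y ≡ i
      ⊗∙-id i refl refl = combine-remQuot {m} n i

      ⊕∙-∘ : ∀ g h i → g ⊕∙ (h ⊕∙ i) ≡ join m n (Sum.map (_∙_ A g ∘ _∙_ A h) (_∙_ B g ∘ _∙_ B h) (splitAt m i))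
      ⊕∙-∘ g h i with splitAt m i
      ... | inj₁ x = cong (join m n ∘ Sum.map (_∙_ A g) (_∙_ B g)) (splitAt-↑ˡ m (_∙_ A h x) n)
      ... | inj₂ y = cong (join m n ∘ Sum.map (_∙_ A g) (_∙_ B g)) (splitAt-↑ʳ m n (_∙_ B h y))

      map-cong : ∀ {f f′ : Fin m → Fin m} {h h′ : Fin n → Fin n} → (∀ x → f x ≡ f′ x) → (∀ y → h y ≡ h′ y) →
        ∀ s → join m n (Sum.map f h s) ≡ join m n (Sum.map f′ h′ s)
      map-cong p q (inj₁ x) = cong (_↑ˡ n) (p x)
      map-cong p q (inj₂ y) = cong (m ↑ʳ_) (q y)

      ⊕∙-id : ∀ {f : Fin m → Fin m} {h : Fin n → Fin n} → (∀ x → f x ≡ x) → (∀ y → h y ≡ y) →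
        ∀ i → join m n (Sum.map f h (splitAt m i)) ≡ i
      ⊕∙-id p q i = trans (map-id (splitAt m i)) (join-splitAt m n i)
        where
        map-id : ∀ s → join m n (Sum.map _ _ s) ≡ join m n s
        map-id (inj₁ x) = cong (_↑ˡ n) (p x)
        map-id (inj₂ y) = cong (m ↑ʳ_) (q y)

    ⊗A : PermAction (V ⊗R W)
    ⊗A = record
      { _∙_     = _⊗∙_
      ; coeff-∙ = coeff-⊗∙
      ; mul-∙   = λ k g h t i → trans (cong₂ combine (mul-∙ A k g h t _) (mul-∙ B k g h t _)) (sym (⊗∙-∘ g h i))
      ; e-∙     = λ g t i → ⊗∙-id i (e-∙ A g t _) (e-∙ B g t _)
      ; inv-∙   = λ g i → trans (⊗∙-∘ (inv g) g i) (⊗∙-id i (inv-∙ A g _) (inv-∙ B g _))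
      ; ∙-inv   = λ g i → trans (⊗∙-∘ g (inv g) i) (⊗∙-id i (∙-inv A g _) (∙-inv B g _))
      }

    ⊕A : PermAction (V ⊕R W)
    ⊕A = record
      { _∙_     = _⊕∙_
      ; coeff-∙ = coeff-⊕∙
      ; mul-∙   = λ k g h t i → trans (map-cong (mul-∙ A k g h t) (mul-∙ B k g h t) (splitAt m i)) (sym (⊕∙-∘ g h i))
      ; e-∙     = λ g t i → ⊕∙-id (e-∙ A g t) (e-∙ B g t) i
      ; inv-∙   = λ g i → trans (⊕∙-∘ (inv g) g i) (⊕∙-id (inv-∙ A g) (inv-∙ B g) i)
      ; ∙-inv   = λ g i → trans (⊕∙-∘ g (inv g) i) (⊕∙-id (∙-inv A g) (∙-inv B g) i)
      }

    ⊕∙-↑ˡ : ∀ g i → _∙_ ⊕A g (i ↑ˡ n) ≡ _∙_ A g i ↑ˡ n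
    ⊕∙-↑ˡ g i = cong (join m n ∘ Sum.map (_∙_ A g) (_∙_ B g)) (splitAt-↑ˡ m i n)

    ⊕∙-↑ʳ : ∀ g j → _∙_ ⊕A g (m ↑ʳ j) ≡ m ↑ʳ _∙_ B g j
    ⊕∙-↑ʳ g j = cong (join m n ∘ Sum.map (_∙_ A g) (_∙_ B g)) (splitAt-↑ʳ m n j)

    ⊗∙-combine : ∀ g i j → _∙_ ⊗A g (combine i j) ≡ combine (_∙_ A g i) (_∙_ B g j)
    ⊗∙-combine g i j = cong (λ p → combine (_∙_ A g (proj₁ p)) (_∙_ B g (proj₂ p))) (remQuot-combine i j)

-- Splitting vectors, and the pairing with the dual space

take-++ : ∀ {A : Set} {m n} (u : Vec A m) (v : Vec A n) → take m (u ++ v) ≡ u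
take-++ []      v = refl
take-++ (x ∷ u) v = cong (x ∷_) (take-++ u v)

drop-++ : ∀ {A : Set} {m n} (u : Vec A m) (v : Vec A n) → drop m (u ++ v) ≡ v
drop-++ []      v = refl
drop-++ (x ∷ u) v = drop-++ u v

lookup-take : ∀ {A : Set} m {n} (w : Vec A (m + n)) i → lookup (take m w) i ≡ lookup w (i ↑ˡ n)
lookup-take (suc m) (x ∷ w) zero    = refl
lookup-take (suc m) (x ∷ w) (suc i) = lookup-take m w i

lookup-drop : ∀ {A : Set} m {n} (w : Vec A (m + n)) j → lookup (drop m w) j ≡ lookup w (m ↑ʳ j)
lookup-drop zero    w       j = refl
lookup-drop (suc m) (x ∷ w) j = lookup-drop m w j

dot-+ᵥ : ∀ {d} (f u v : Vec Bool d) → dot f (u +ᵥ v) ≡ dot f u xor dot f v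
dot-+ᵥ {d} f u v = trans
  (ΣF-cong d (λ i → trans (cong (lookup f i ∧_) (lookup-+ᵥ u v i)) (∧-distribˡ-xor (lookup f i) _ _)))
  (ΣF-xor d _ _)

dot-take-drop : ∀ m {n} (w x : Vec Bool (m + n)) → dot w x ≡ dot (take m w) (take m x) xor dot (drop m w) (drop m x)
dot-take-drop m {n} w x = trans (ΣF-+ m n _) (cong₂ _xor_
  (ΣF-cong m (λ i → sym (cong₂ _∧_ (lookup-take m w i) (lookup-take m x i))))
  (ΣF-cong n (λ j → sym (cong₂ _∧_ (lookup-drop m w j) (lookup-drop m x j)))))

unit : ∀ {d} → Fin d → Vec Bool d
unit i = tabulate (λ j → eqF j i)

lookup-0ᵥ : ∀ {d} (i : Fin d) → lookup 0ᵥ i ≡ false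
lookup-0ᵥ i = lookup-replicate i false

-- Meant for the values of tensor functors, whose points are given as sums of lists of generators.
sumᵥ-vanish : ∀ {d} (ℓ : Vec Bool d → Bool) → ℓ 0ᵥ ≡ false → (∀ u v → ℓ (u +ᵥ v) ≡ ℓ u xor ℓ v) →
  ∀ {ps} → All (λ p → ℓ p ≡ false) ps → ℓ (sumᵥ ps) ≡ false
sumᵥ-vanish ℓ z a All.[]       = z
sumᵥ-vanish ℓ z a (p All.∷ ps) = trans (a _ _) (cong₂ _xor_ p (sumᵥ-vanish ℓ z a ps))

-- A constructible functor whose value is a kernel

module KernelFunctor (N : ℕ) where
  open Alg N
  open Representations N
  open PermAction using (isRep; LevelLE-dual; _∙_; ∙-injective)

  private
    W₂ = permR ⊗R permR
    W₃ = W₂ ⊗R permR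
    A₂ = ⊗A permA permA
    A₃ = ⊗A A₂ permA
    A₃₃ = ⊕A A₃ A₃
    Aᵥ₁ = ⊕A A₂ permA
    Aᵥ₂ = ⊕A Aᵥ₁ permA

  VrepA : PermAction Vrep
  VrepA = ⊕A Aᵥ₂ trivA

  -- `edgeIx`, `colIx` and `oneIx` address the coordinates of U ⊗ U, of the first copy of U (the
  -- indicator of X₁) and of k. The sum is nested to the left, hence the chains of injections.
  edgeIx : Fin (N * N) → Fin (dim Vrep)
  edgeIx a = ((a ↑ˡ N) ↑ˡ N) ↑ˡ 1

  colIx : Fin N → Fin (dim Vrep)
  colIx u = ((N * N ↑ʳ u) ↑ˡ N) ↑ˡ 1

  oneIx : Fin (dim Vrep)
  oneIx = (N * N + N + N) ↑ʳ zero

  edgeIx-∙ : ∀ g a → _∙_ VrepA g (edgeIx a) ≡ edgeIx (_∙_ A₂ g a)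
  edgeIx-∙ g a = trans (⊕∙-↑ˡ Aᵥ₂ trivA g _) (cong (_↑ˡ 1)
    (trans (⊕∙-↑ˡ Aᵥ₁ permA g _) (cong (_↑ˡ N) (⊕∙-↑ˡ A₂ permA g a))))

  colIx-∙ : ∀ g u → _∙_ VrepA g (colIx u) ≡ colIx (lookup (fwd g) u)
  colIx-∙ g u = trans (⊕∙-↑ˡ Aᵥ₂ trivA g _) (cong (_↑ˡ 1)
    (trans (⊕∙-↑ˡ Aᵥ₁ permA g _) (cong (_↑ˡ N) (⊕∙-↑ʳ A₂ permA g u))))

  oneIx-∙ : ∀ g → _∙_ VrepA g oneIx ≡ oneIx
  oneIx-∙ g = ⊕∙-↑ʳ Aᵥ₂ trivA g zero

  row col : Fin (N * N) → Fin N
  row a = proj₁ (remQuot {N} N a)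
  col a = proj₂ (remQuot {N} N a)

  diag : Fin (N * N) → Bool
  diag a = eqF (row a) (col a)

  row-∙ : ∀ g a → row (_∙_ A₂ g a) ≡ lookup (fwd g) (row a)
  row-∙ g a = cong proj₁ (remQuot-combine (lookup (fwd g) (row a)) _)

  col-∙ : ∀ g a → col (_∙_ A₂ g a) ≡ lookup (fwd g) (col a)
  col-∙ g a = cong proj₂ (remQuot-combine (lookup (fwd g) (row a)) (lookup (fwd g) (col a)))

  eqF-fwd : ∀ g i j → eqF (lookup (fwd g) i) (lookup (fwd g) j) ≡ eqF i j
  eqF-fwd g = eqF-injective (∙-injective permA g)

  diag-∙ : ∀ g a → diag (_∙_ A₂ g a) ≡ diag a
  diag-∙ g a = trans (cong₂ eqF (row-∙ g a) (col-∙ g a)) (eqF-fwd g (row a) (col a))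

  eqF-VrepA : ∀ g k {l l′} → _∙_ VrepA g l ≡ l′ → eqF (_∙_ VrepA g k) l′ ≡ eqF k l
  eqF-VrepA g k {l} refl = eqF-injective (∙-injective VrepA g) k l

  -- (A, p, q, c) ↦ A + c I.
  adjPlusOne : Mat (N * N) (dim Vrep)
  adjPlusOne a k = eqF k (edgeIx a) xor (eqF k oneIx ∧ diag a)

  -- (A, p, q, c) ↦ diag p.
  colourDiag : Mat (N * N) (dim Vrep)
  colourDiag a k = eqF k (colIx (row a)) ∧ diag a

  -- u ⊗ v ⊗ w ↦ ⟨u , w⟩ v.
  contract : Mat N (N * N * N)
  contract j s = eqF (row a) l ∧ eqF (col a) j
    where
    a = proj₁ (remQuot {N * N} N s)
    l = proj₂ (remQuot {N * N} N s)

  -- Adding two subspaces of U is not among the basic operations; it is obtained as a direct sum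
  -- followed by this equivariant map, which contracts both blocks and adds the results.
  contract₂ : Mat N (N * N * N + N * N * N)
  contract₂ j t = [ contract j , contract j ]′ (splitAt (N * N * N) t)

  adjPlusOne-equivariant : Equivariant Vrep W₂ adjPlusOne
  adjPlusOne-equivariant = equivariant VrepA A₂ adjPlusOne λ g a k → cong₂ _xor_
    (eqF-VrepA g k (edgeIx-∙ g a)) (cong₂ _∧_ (eqF-VrepA g k (oneIx-∙ g)) (diag-∙ g a))

  colourDiag-equivariant : Equivariant Vrep W₂ colourDiag
  colourDiag-equivariant = equivariant VrepA A₂ colourDiag λ g a k → cong₂ _∧_
    (eqF-VrepA g k (trans (colIx-∙ g (row a)) (cong colIx (sym (row-∙ g a))))) (diag-∙ g a)

  contract-∙ : ∀ g j s → contract (lookup (fwd g) j) (_∙_ A₃ g s) ≡ contract j s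
  contract-∙ g j s = trans
    (cong (λ p → eqF (row (proj₁ p)) (proj₂ p) ∧ eqF (col (proj₁ p)) (lookup (fwd g) j)) (remQuot-combine (_∙_ A₂ g a) (lookup (fwd g) l)))
    (cong₂ _∧_ (trans (cong (λ x → eqF x (lookup (fwd g) l)) (row-∙ g a)) (eqF-fwd g (row a) l))
               (trans (cong (λ x → eqF x (lookup (fwd g) j)) (col-∙ g a)) (eqF-fwd g (col a) j)))
    where
    a = proj₁ (remQuot {N * N} N s)
    l = proj₂ (remQuot {N * N} N s)

  contract₂-equivariant : Equivariant (W₃ ⊕R W₃) permR contract₂
  contract₂-equivariant = equivariant A₃₃ permA contract₂ λ g j t → trans
    (cong [ contract _ , contract _ ]′ (splitAt-join (N * N * N) (N * N * N) (Sum.map (_∙_ A₃ g) (_∙_ A₃ g) (splitAt (N * N * N) t))))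
    (blocks g j (splitAt (N * N * N) t))
    where
    blocks : ∀ g j s → [ contract (lookup (fwd g) j) , contract (lookup (fwd g) j) ]′ (Sum.map (_∙_ A₃ g) (_∙_ A₃ g) s) ≡ [ contract j , contract j ]′ s
    blocks g j (inj₁ s) = contract-∙ g j s
    blocks g j (inj₂ s) = contract-∙ g j s

  level₂ : LevelLE W₂ 2
  level₂ = LevelLE-⊗ {permR} {permR} LevelLE-permR LevelLE-permR

  LevelLE-Vrep : LevelLE Vrep 2
  LevelLE-Vrep = LevelLE-⊕ {Aᵥ₂′} {trivR} (LevelLE-⊕ {W₂ ⊕R permR} {permR} (LevelLE-⊕ {W₂} {permR} level₂ level₁) level₁) (LevelLE-trivR 2)
    where
    Aᵥ₂′ = (W₂ ⊕R permR) ⊕R permR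
    level₁ : LevelLE permR 2
    level₁ = LevelLE-weaken 1 {V = permR} LevelLE-permR

  level₃-permR : LevelLE permR 3
  level₃-permR = LevelLE-weaken 2 {V = permR} LevelLE-permR

  -- With M the matrix `f` A, the value is the affine span of all M ⊗ u. It contains M ⊗ 0 = 0, so
  -- it is linear, and `contract` maps M ⊗ u to the transpose of M applied to u: the image is the
  -- row space of M.
  rowSpace : (f : Mat (N * N) (dim Vrep)) → Equivariant Vrep W₂ f → CFun Vrep W₃ co
  rowSpace f eq = cTen 2 1 ≤-refl level₂ LevelLE-permR
    (cLin W₂ (isRep A₂) (LevelLE-weaken 1 {V = W₂} level₂) f eq)
    (cFull permR (isRep permA) level₃-permR)

  -- `cDual` yields the functionals equal to 1 rather than those equal to 0. Because of the summand
  -- `cConst true`, a functional (f, c) must satisfy f(z) + c = 1 for every z in a linear subspace;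
  -- z = 0 forces c = 1, and then f annihilates the subspace.
  kernelFunctor : CFun Vrep (dualR (permR ⊕R trivR)) contra
  kernelFunctor = cComp
    (cSum (cComp (cSum (rowSpace adjPlusOne adjPlusOne-equivariant) (rowSpace colourDiag colourDiag-equivariant))
                 (cLin permR (isRep permA) level₃-permR contract₂ contract₂-equivariant))
          (cConst true))
    (cDual (LevelLE-dual (⊕A permA trivA) (LevelLE-⊕ {permR} {trivR} level₃-permR (LevelLE-trivR 3))))

  Kernel : Vec Bool (N * N) → Subset N
  Kernel M f = ∀ (i : Fin N) → ΣF N (λ j → lookup M (combine i j) ∧ lookup f j) ≡ false

  apply-+ᵥ : ∀ {d d′} (h : Mat d′ d) u v → apply h (u +ᵥ v) ≡ apply h u +ᵥ apply h v
  apply-+ᵥ {d} h u v = lookup-ext λ i → begin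
    lookup (apply h (u +ᵥ v)) i                                  ≡⟨ lookup∘tabulate _ i ⟩
    ΣF d (λ j → h i j ∧ lookup (u +ᵥ v) j)                       ≡⟨ ΣF-cong d (λ j → trans (cong (h i j ∧_) (lookup-+ᵥ u v j)) (∧-distribˡ-xor (h i j) _ _)) ⟩
    ΣF d (λ j → (h i j ∧ lookup u j) xor (h i j ∧ lookup v j))   ≡⟨ ΣF-xor d _ _ ⟩
    _                                                            ≡⟨ sym (cong₂ _xor_ (lookup∘tabulate _ i) (lookup∘tabulate _ i)) ⟩
    lookup (apply h u) i xor lookup (apply h v) i                ≡⟨ sym (lookup-+ᵥ (apply h u) (apply h v) i) ⟩
    lookup (apply h u +ᵥ apply h v) i                            ∎
    where open ≡-Reasoning

  apply-contract₂ : ∀ t → apply contract₂ t ≡ apply contract (take (N * N * N) t) +ᵥ apply contract (drop (N * N * N) t)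
  apply-contract₂ t = lookup-ext λ j → begin
    lookup (apply contract₂ t) j                        ≡⟨ lookup∘tabulate _ j ⟩
    ΣF (m + m) (λ s → contract₂ j s ∧ lookup t s)       ≡⟨ ΣF-+ m m _ ⟩
    _                                                   ≡⟨ cong₂ _xor_
       (ΣF-cong m (λ s → cong₂ _∧_ (cong [ contract j , contract j ]′ (splitAt-↑ˡ m s m)) (sym (lookup-take m t s))))
       (ΣF-cong m (λ s → cong₂ _∧_ (cong [ contract j , contract j ]′ (splitAt-↑ʳ m m s)) (sym (lookup-drop m t s)))) ⟩
    _                                                   ≡⟨ sym (cong₂ _xor_ (lookup∘tabulate _ j) (lookup∘tabulate _ j)) ⟩
    lookup (apply contract (take m t)) j xor lookup (apply contract (drop m t)) j
                                                        ≡⟨ sym (lookup-+ᵥ (apply contract (take m t)) _ j) ⟩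
    _ ∎
    where
    open ≡-Reasoning
    m = N * N * N

  lookup-contract : ∀ M u j → lookup (apply contract (M ⊗ᵥ u)) j ≡ ΣF N (λ i → lookup M (combine i j) ∧ lookup u i)
  lookup-contract M u j = begin
    lookup (apply contract (M ⊗ᵥ u)) j
      ≡⟨ lookup∘tabulate _ j ⟩
    ΣF (N * N * N) (λ s → contract j s ∧ lookup (M ⊗ᵥ u) s)
      ≡⟨ ΣF-* (N * N) N _ ⟩
    ΣF (N * N) (λ a → ΣF N (λ l → contract j (combine a l) ∧ lookup (M ⊗ᵥ u) (combine a l)))
      ≡⟨ ΣF-cong (N * N) (λ a → ΣF-cong N (λ l → cong₂ _∧_
           (cong (λ p → eqF (row (proj₁ p)) (proj₂ p) ∧ eqF (col (proj₁ p)) j) (remQuot-combine a l))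
           (trans (lookup∘tabulate _ (combine a l)) (cong (λ p → lookup M (proj₁ p) ∧ lookup u (proj₂ p)) (remQuot-combine a l))))) ⟩
    ΣF (N * N) (λ a → ΣF N (λ l → (eqF (row a) l ∧ eqF (col a) j) ∧ (lookup M a ∧ lookup u l)))
      ≡⟨ ΣF-cong (N * N) (λ a → trans (ΣF-cong N (λ l → ∧-assoc (eqF (row a) l) _ _)) (ΣF-eqF′ N (row a) (λ l → eqF (col a) j ∧ (lookup M a ∧ lookup u l)))) ⟩
    ΣF (N * N) (λ a → eqF (col a) j ∧ (lookup M a ∧ lookup u (row a)))
      ≡⟨ ΣF-* N N _ ⟩
    ΣF N (λ i → ΣF N (λ k → eqF (col (combine i k)) j ∧ (lookup M (combine i k) ∧ lookup u (row (combine i k)))))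
      ≡⟨ ΣF-cong N (λ i → ΣF-cong N (λ k → cong (λ p → eqF (proj₂ p) j ∧ (lookup M (combine i k) ∧ lookup u (proj₁ p))) (remQuot-combine i k))) ⟩
    ΣF N (λ i → ΣF N (λ k → eqF k j ∧ (lookup M (combine i k) ∧ lookup u i)))
      ≡⟨ ΣF-cong N (λ i → ΣF-eqF N j (λ k → lookup M (combine i k) ∧ lookup u i)) ⟩
    ΣF N (λ i → lookup M (combine i j) ∧ lookup u i) ∎
    where open ≡-Reasoning

  pairing : Vec Bool N → Vec Bool (N * N * N) → Bool
  pairing f t = dot f (apply contract t)

  pairing-+ᵥ : ∀ f s t → pairing f (s +ᵥ t) ≡ pairing f s xor pairing f t
  pairing-+ᵥ f s t = trans (cong (dot f) (apply-+ᵥ contract s t)) (dot-+ᵥ f (apply contract s) (apply contract t))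

  pairing-0ᵥ : ∀ f → pairing f 0ᵥ ≡ false
  pairing-0ᵥ f = trans (cong (pairing f) (sym (+ᵥ-same 0ᵥ))) (trans (pairing-+ᵥ f 0ᵥ 0ᵥ) (xor-same (pairing f 0ᵥ)))

  -- Exchanging the two sums moves M from u to f. Therefore annihilating the row space of M is the
  -- same as lying in the kernel of M.
  pairing-⊗ : ∀ f M u → pairing f (M ⊗ᵥ u) ≡ ΣF N (λ i → lookup u i ∧ ΣF N (λ j → lookup M (combine i j) ∧ lookup f j))
  pairing-⊗ f M u = begin
    ΣF N (λ j → lookup f j ∧ lookup (apply contract (M ⊗ᵥ u)) j)
      ≡⟨ ΣF-cong N (λ j → trans (cong (lookup f j ∧_) (lookup-contract M u j)) (∧-ΣF N (lookup f j) _)) ⟩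
    ΣF N (λ j → ΣF N (λ i → lookup f j ∧ (lookup M (combine i j) ∧ lookup u i)))
      ≡⟨ ΣF-swap N N _ ⟩
    ΣF N (λ i → ΣF N (λ j → lookup f j ∧ (lookup M (combine i j) ∧ lookup u i)))
      ≡⟨ ΣF-cong N (λ i → trans (ΣF-cong N (λ j → rotate (lookup f j) (lookup M (combine i j)) (lookup u i))) (sym (∧-ΣF N (lookup u i) _))) ⟩
    ΣF N (λ i → lookup u i ∧ ΣF N (λ j → lookup M (combine i j) ∧ lookup f j)) ∎
    where
    open ≡-Reasoning
    rotate : ∀ p q r → p ∧ (q ∧ r) ≡ r ∧ (q ∧ p)
    rotate p q r = trans (∧-comm p (q ∧ r)) (trans (cong (_∧ p) (∧-comm q r)) (∧-assoc r q p))

  pairing-⊗0ᵥ : ∀ f M → pairing f (M ⊗ᵥ 0ᵥ) ≡ false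
  pairing-⊗0ᵥ f M = trans (pairing-⊗ f M 0ᵥ) (ΣF-false N (λ i → cong (_∧ ΣF N (λ j → lookup M (combine i j) ∧ lookup f j)) (lookup-0ᵥ i)))

  pairing-⊗unit : ∀ f M i → pairing f (M ⊗ᵥ unit i) ≡ ΣF N (λ j → lookup M (combine i j) ∧ lookup f j)
  pairing-⊗unit f M i = trans (pairing-⊗ f M (unit i))
    (trans (ΣF-cong N (λ k → cong (_∧ _) (lookup∘tabulate _ k))) (ΣF-eqF N i _))

  module _ (A : Vec Bool (dim Vrep)) where
    private
      X : Subset (dim Vrep)
      X v = v ≡ A
      M₁ = apply adjPlusOne A
      M₂ = apply colourDiag A

    rowSpace-intro : ∀ f eq u → sem (rowSpace f eq) X (apply f A ⊗ᵥ u)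
    rowSpace-intro f eq u =
      (apply f A ⊗ᵥ u) L.∷ L.[] , ((apply f A , u , (A , refl , refl) , tt , refl) All.∷ All.[]) , tt ,
      trans (+ᵥ-comm (apply f A ⊗ᵥ u) 0ᵥ) (+ᵥ-identityˡ _)

    rowSpace-vanish : ∀ f eq φ → Kernel (apply f A) φ → ∀ t → sem (rowSpace f eq) X t → pairing φ t ≡ false
    rowSpace-vanish f eq φ K _ (ps , all , _ , refl) = sumᵥ-vanish (pairing φ) (pairing-0ᵥ φ) (pairing-+ᵥ φ) (All.map vanish all)
      where
      vanish : ∀ {w} →
        (Σ (Vec Bool (N * N)) λ y → Σ (Vec Bool N) λ u → (Σ (Vec Bool (dim Vrep)) λ x → x ≡ A × apply f x ≡ y) × ⊤ × (y ⊗ᵥ u) ≡ w) →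
        pairing φ w ≡ false
      vanish (_ , u , (_ , refl , refl) , _ , refl) =
        trans (pairing-⊗ φ (apply f A) u) (ΣF-false N (λ i → trans (cong (lookup u i ∧_) (K i)) (∧-zeroʳ _)))

    dot-contract₂ : ∀ f t → dot f (apply contract₂ t) ≡ pairing f (take (N * N * N) t) xor pairing f (drop (N * N * N) t)
    dot-contract₂ f t = trans (cong (dot f) (apply-contract₂ t)) (dot-+ᵥ f (apply contract (take (N * N * N) t)) (apply contract (drop (N * N * N) t)))

    kernelFunctor-complete : ∀ w → Kernel M₁ (take N w) → Kernel M₂ (take N w) → drop N w ≡ true ∷ [] → sem kernelFunctor X w
    kernelFunctor-complete w K₁ K₂ w₁ x ((t , (s₁ , s₂) , e) , x₁) = trans (dot-take-drop N w x) (cong₂ _xor_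
      (trans (cong (dot (take N w)) (sym e)) (trans (dot-contract₂ (take N w) t) (cong₂ _xor_
        (rowSpace-vanish adjPlusOne adjPlusOne-equivariant (take N w) K₁ _ s₁)
        (rowSpace-vanish colourDiag colourDiag-equivariant (take N w) K₂ _ s₂))))
      (cong₂ dot w₁ x₁))

    -- The functional is tested on the points coming from a pair (u, v): the pair (0, 0) gives the
    -- last coordinate, after which (`unit i`, 0) and (0, `unit i`) isolate row i of each matrix.
    kernelFunctor-sound : ∀ w → sem kernelFunctor X w → Kernel M₁ (take N w) × Kernel M₂ (take N w) × drop N w ≡ true ∷ []
    kernelFunctor-sound w H = K₁ , K₂ , w₁
      where
      m = N * N * N
      f = take N w
      values : ∀ u v → (pairing f (M₁ ⊗ᵥ u) xor pairing f (M₂ ⊗ᵥ v)) xor dot (drop N w) (true ∷ []) ≡ true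
      values u v = trans (sym (trans (dot-take-drop N w x) (cong₂ _xor_
          (trans (cong (dot f) (take-++ z _)) (trans (dot-contract₂ f t)
            (cong₂ _xor_ (cong (pairing f) (take-++ (M₁ ⊗ᵥ u) _)) (cong (pairing f) (drop-++ (M₁ ⊗ᵥ u) _)))))
          (cong (dot (drop N w)) (drop-++ z _)))))
        (H x ((t , (subst (sem (rowSpace adjPlusOne adjPlusOne-equivariant) X) (sym (take-++ (M₁ ⊗ᵥ u) _)) (rowSpace-intro adjPlusOne adjPlusOne-equivariant u)
                 , subst (sem (rowSpace colourDiag colourDiag-equivariant) X) (sym (drop-++ (M₁ ⊗ᵥ u) _)) (rowSpace-intro colourDiag colourDiag-equivariant v))
              , sym (take-++ z _)) , drop-++ z _))
        where
        t = (M₁ ⊗ᵥ u) ++ (M₂ ⊗ᵥ v)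
        z = apply contract₂ t
        x = z ++ (true ∷ [])
      last : dot (drop N w) (true ∷ []) ≡ true
      last = trans (cong (_xor _) (sym (cong₂ _xor_ (pairing-⊗0ᵥ f M₁) (pairing-⊗0ᵥ f M₂)))) (values 0ᵥ 0ᵥ)
      w₁ : drop N w ≡ true ∷ []
      w₁ = single (drop N w) last
        where
        single : ∀ v → dot v (true ∷ []) ≡ true → v ≡ true ∷ []
        single (true ∷ []) _ = refl
      xor-true : ∀ p → p xor true ≡ true → p ≡ false
      xor-true false _ = refl
      sums : ∀ u v → pairing f (M₁ ⊗ᵥ u) xor pairing f (M₂ ⊗ᵥ v) ≡ false
      sums u v = xor-true _ (trans (cong ((pairing f (M₁ ⊗ᵥ u) xor pairing f (M₂ ⊗ᵥ v)) xor_) (sym last)) (values u v))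
      K₁ : Kernel M₁ f
      K₁ i = trans (sym (trans (cong₂ _xor_ (pairing-⊗unit f M₁ i) (pairing-⊗0ᵥ f M₂)) (xor-identityʳ _))) (sums (unit i) 0ᵥ)
      K₂ : Kernel M₂ f
      K₂ i = trans (sym (cong₂ _xor_ (pairing-⊗0ᵥ f M₁) (pairing-⊗unit f M₂ i))) (sums 0ᵥ (unit i))

-- Recurrence of injective maps, and sums over the group

T-⇔⇒≡ : ∀ {p q} → (T p → T q) → (T q → T p) → p ≡ q
T-⇔⇒≡ {true}  {true}  to from = refl
T-⇔⇒≡ {true}  {false} to from = ⊥-elim (to tt)
T-⇔⇒≡ {false} {true}  to from = ⊥-elim (from tt)
T-⇔⇒≡ {false} {false} to from = refl

≡⇒T : ∀ {p} → p ≡ true → T p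
≡⇒T = Equivalence.from T-≡

sumL-tabulate : ∀ {A : Set} n (f : A → Bool) (h : Fin n → A) → sumL f (L.tabulate h) ≡ ΣF n (f ∘ h)
sumL-tabulate zero    f h = refl
sumL-tabulate (suc n) f h = cong (f (h zero) xor_) (sumL-tabulate n f (h ∘ suc))

sumL-mapMaybe : ∀ {A B : Set} (f : B → Bool) (h : A → Maybe B) (xs : List A) →
  sumL f (L.mapMaybe h xs) ≡ sumL (maybe f false ∘ h) xs
sumL-mapMaybe f h L.[]       = refl
sumL-mapMaybe f h (x L.∷ xs) with h x
... | just y  = cong (f y xor_) (sumL-mapMaybe f h xs)
... | nothing = sumL-mapMaybe f h xs

decT-nothing : ∀ b → decT b ≡ nothing → b ≡ false
decT-nothing false _ = refl

iterate : ∀ {A : Set} → (A → A) → ℕ → A → A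
iterate f zero    x = x
iterate f (suc n) x = f (iterate f n x)

code : ∀ {n} → Vec Bool n → Fin (2 ^ n)
code []      = zero
code (b ∷ v) = combine (bit b) (code v)
  where
  bit : Bool → Fin 2
  bit false = zero
  bit true  = suc zero

code-injective : ∀ {n} {u v : Vec Bool n} → code u ≡ code v → u ≡ v
code-injective {u = []}        {[]}        e = refl
code-injective {u = false ∷ u} {false ∷ v} e = cong (false ∷_) (code-injective (proj₂ (combine-injective {2} zero (code u) zero (code v) e)))
code-injective {u = true ∷ u}  {true ∷ v}  e = cong (true ∷_) (code-injective (proj₂ (combine-injective {2} (suc zero) (code u) (suc zero) (code v) e)))
code-injective {u = false ∷ u} {true ∷ v}  e with () ← proj₁ (combine-injective {2} zero (code u) (suc zero) (code v) e)
code-injective {u = true ∷ u}  {false ∷ v} e with () ← proj₁ (combine-injective {2} (suc zero) (code u) zero (code v) e)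

-- An injective self-map of a finite set returns every point to itself after finitely many steps.
injective-recurrent : ∀ {n} {P P′ : Subset n} (t : Vec Bool n → Vec Bool n) → Injective _≡_ _≡_ t →
  (∀ v → P v → P′ (t v)) → (∀ v → P′ v → P v) → ∀ v → P v → P′ v
injective-recurrent {n} {P} {P′} t inj step sub v Pv
  with i , j , i<j , e ← pigeonhole (n<1+n (2 ^ n)) (λ i → code (iterate t (toℕ i) v))
  = return (toℕ i) (toℕ j) i<j (code-injective e)
  where
  orbit : ∀ k → P (iterate t k v)
  orbit zero    = Pv
  orbit (suc k) = sub _ (step _ (orbit k))
  return : ∀ i j → i < j → iterate t i v ≡ iterate t j v → P′ v
  -- Injectivity has cancelled the common iterates, so `v` is the image under `t` of a point of its
  -- own orbit. The orbit stays in `P`, hence this image lies in `P′`.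
  return zero    (suc j) _         e = subst P′ (sym e) (step _ (orbit j))
  return (suc i) (suc j) (s≤s i<j) e = return i j i<j (inj e)

module Enumeration (N : ℕ) where
  open Alg N
  open Representations N

  agrees : ∀ {m} → (Fin m → Fin N) → Vec (Fin N) m → Bool
  agrees {m} s v = allF m (λ x → eqF (lookup v x) (s x))

  -- `agrees s` is the indicator of the single vector `tabulate s`, and the enumeration lists every
  -- vector once; the induction sums out one coordinate at a time.
  sum-allVecs : ∀ m (s : Fin m → Fin N) (H : Vec (Fin N) m → Bool) →
    sumL (λ v → agrees s v ∧ H v) (allVecs m) ≡ H (tabulate s)
  sum-allVecs zero    s H = xor-identityʳ (H [])
  sum-allVecs (suc m) s H = begin
    sumL (λ v → agrees s v ∧ H v) (allVecs (suc m))
      ≡⟨ sumL-concatMap _ (λ i → L.map (i ∷_) (allVecs m)) (L.allFin N) ⟩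
    sumL (λ i → sumL (λ v → agrees s v ∧ H v) (L.map (i ∷_) (allVecs m))) (L.allFin N)
      ≡⟨ sumL-cong (L.allFin N) (λ i → sumL-map _ (i ∷_) (allVecs m)) ⟩
    sumL (λ i → sumL (λ v → (eqF i (s zero) ∧ agrees (s ∘ suc) v) ∧ H (i ∷ v)) (allVecs m)) (L.allFin N)
      ≡⟨ sumL-cong (L.allFin N) (λ i → trans
           (sumL-cong (allVecs m) (λ v → ∧-assoc (eqF i (s zero)) _ _))
           (trans (sym (∧-sumL (eqF i (s zero)) (λ v → agrees (s ∘ suc) v ∧ H (i ∷ v)) (allVecs m)))
                  (cong (eqF i (s zero) ∧_) (sum-allVecs m (s ∘ suc) (H ∘ (i ∷_)))))) ⟩
    sumL (λ i → eqF i (s zero) ∧ H (i ∷ tabulate (s ∘ suc))) (L.allFin N)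
      ≡⟨ sumL-tabulate N _ id ⟩
    ΣF N (λ i → eqF i (s zero) ∧ H (i ∷ tabulate (s ∘ suc)))
      ≡⟨ ΣF-eqF N (s zero) _ ⟩
    H (tabulate s) ∎
    where open ≡-Reasoning

  mutuallyInverse : Perm → Perm → Bool
  mutuallyInverse v w = isId (compP v w) ∧ isId (compP w v)

  sum-toG : ∀ (K : Perm → Bool) v w → maybe (K ∘ fwd) false (toG v w) ≡ mutuallyInverse v w ∧ K v
  sum-toG K v w with decT (isId (compP v w) ∧ isId (compP w v)) in e
  ... | just p  = cong (_∧ K v) (sym (Equivalence.to T-≡ p))
  ... | nothing = cong (_∧ K v) (sym (decT-nothing _ e))

  isId-intro : ∀ p q → (∀ i → lookup p (lookup q i) ≡ i) → T (isId (compP p q))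
  isId-intro p q e = ≡⇒T (∀⇒allF N _ (λ i → trans (cong (λ x → eqF x i) (trans (lookup∘tabulate _ i) (e i))) (eqF-refl i)))

  module _ (s t : Fin N → Fin N) (st : ∀ i → s (t i) ≡ i) (ts : ∀ i → t (s i) ≡ i) where

    mutuallyInverse-agrees : ∀ w → mutuallyInverse (tabulate s) w ≡ agrees t w
    mutuallyInverse-agrees w = T-⇔⇒≡
      (λ p → ≡⇒T (∀⇒allF N _ (λ x → trans (cong (λ y → eqF y (t x)) (w≡t (isId⇒ (tabulate s) w (proj₁ (Equivalence.to T-∧ p))) x)) (eqF-refl (t x)))))
      (λ p → Equivalence.from T-∧
        ( isId-intro (tabulate s) w (λ i → trans (lookup∘tabulate s _) (trans (cong s (eqF⇒≡ (allF⇒∀ N _ p i))) (st i)))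
        , isId-intro w (tabulate s) (λ i → trans (cong (lookup w) (lookup∘tabulate s i)) (trans (eqF⇒≡ (allF⇒∀ N _ p (s i))) (ts i)))))
      where
      w≡t : (∀ i → lookup (tabulate s) (lookup w i) ≡ i) → ∀ i → lookup w i ≡ t i
      w≡t e i = trans (sym (ts (lookup w i))) (cong t (trans (sym (lookup∘tabulate s _)) (e i)))

    -- An element of G stores a permutation together with its inverse. The inverse is determined, so
    -- the enumeration of pairs meets each permutation exactly once, and the indicator of `s` leaves
    -- one term.
    sumG-select : ∀ (H : Perm → Bool) → sumG (λ k → agrees s (fwd k) ∧ H (fwd k)) ≡ H (tabulate s)
    sumG-select H = begin
      sumL (K ∘ fwd) allG
        ≡⟨ sumL-concatMap (K ∘ fwd) (λ v → L.mapMaybe (toG v) (allVecs N)) (allVecs N) ⟩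
      sumL (λ v → sumL (K ∘ fwd) (L.mapMaybe (toG v) (allVecs N))) (allVecs N)
        ≡⟨ sumL-cong (allVecs N) (λ v → trans (sumL-mapMaybe (K ∘ fwd) (toG v) (allVecs N)) (sumL-cong (allVecs N) (λ w → trans (sum-toG K v w) (∧-comm (mutuallyInverse v w) (K v))))) ⟩
      sumL (λ v → sumL (λ w → K v ∧ mutuallyInverse v w) (allVecs N)) (allVecs N)
        ≡⟨ sumL-cong (allVecs N) (λ v → trans (sym (∧-sumL (K v) (mutuallyInverse v) (allVecs N))) (∧-assoc (agrees s v) (H v) _)) ⟩
      sumL (λ v → agrees s v ∧ (H v ∧ sumL (mutuallyInverse v) (allVecs N))) (allVecs N)
        ≡⟨ sum-allVecs N s (λ v → H v ∧ sumL (mutuallyInverse v) (allVecs N)) ⟩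
      H (tabulate s) ∧ sumL (mutuallyInverse (tabulate s)) (allVecs N)
        ≡⟨ cong (H (tabulate s) ∧_) (trans (sumL-cong (allVecs N) (λ w → trans (mutuallyInverse-agrees w) (sym (∧-identityʳ _)))) (sum-allVecs N t (λ _ → true))) ⟩
      H (tabulate s) ∧ true
        ≡⟨ ∧-identityʳ _ ⟩
      H (tabulate s) ∎
      where
      open ≡-Reasoning
      K : Perm → Bool
      K v = agrees s v ∧ H v

-- The action of morphisms on U

module Intertwining (N : ℕ) where
  open Alg N
  open Representations N
  open PermAction using (lookup-act; _∙_)
  open KernelFunctor N
  open Enumeration N

  _·_ : G → Fin N → Fin N
  g · i = lookup (fwd g) i

  -- The transpose of the operator Σ_g ψ(g) g on U.
  pull : R → Vec Bool N → Vec Bool N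
  pull ψ f = tabulate (λ j → sumG (λ g → ψ g ∧ lookup f (g · j)))

  -- Transposition reverses products, so `pull ψ` is applied before `pull φ`. The test functions k ↦
  -- f(k · j) are those through which an element of R₃* acts on U.
  comp3-eval : ∀ ψ φ f j → comp3 ψ φ (λ k → lookup f (k · j)) ≡ lookup (pull φ (pull ψ f)) j
  comp3-eval ψ φ f j = begin
    sumG (λ g → sumG (λ h → sumG (λ k → isMul k g h ∧ ψ g ∧ φ h ∧ lookup f (k · j))))
      ≡⟨ sumL-cong allG (λ g → sumL-cong allG (λ h → trans
           -- `isMul k g h` leaves only k = gh, whose inverse is h⁻¹g⁻¹.
           (sumG-select (λ x → g · (h · x)) (λ x → lookup (bwd h) (lookup (bwd g) x))
             (λ i → trans (cong (g ·_) (fwd-bwd h _)) (fwd-bwd g i))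
             (λ i → trans (cong (lookup (bwd h)) (bwd-fwd g _)) (bwd-fwd h i))
             (λ v → ψ g ∧ φ h ∧ lookup f (lookup v j)))
           (trans (cong (λ x → ψ g ∧ φ h ∧ lookup f x) (lookup∘tabulate _ j)) (∧-swap (ψ g) (φ h) _)))) ⟩
    sumG (λ g → sumG (λ h → φ h ∧ ψ g ∧ lookup f (g · (h · j))))
      ≡⟨ sumL-swap (λ g h → φ h ∧ ψ g ∧ lookup f (g · (h · j))) allG allG ⟩
    sumG (λ h → sumG (λ g → φ h ∧ ψ g ∧ lookup f (g · (h · j))))
      ≡⟨ sumL-cong allG (λ h → trans (sym (∧-sumL (φ h) (λ g → ψ g ∧ lookup f (g · (h · j))) allG)) (cong (φ h ∧_) (sym (lookup∘tabulate _ (h · j))))) ⟩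
    sumG (λ h → φ h ∧ lookup (pull ψ f) (h · j))
      ≡⟨ sym (lookup∘tabulate _ j) ⟩
    lookup (pull φ (pull ψ f)) j ∎
    where open ≡-Reasoning

  ε3-eval : ∀ f j → ε3 (λ k → lookup f (k · j)) ≡ lookup f j
  ε3-eval f j = trans (sumG-select id id (λ _ → refl) (λ _ → refl) (λ v → lookup f (lookup v j)))
    (cong (lookup f) (lookup∘tabulate id j))

  -- The function is a combination of matrix coefficients and so has level 1. This makes the
  -- identities of an isomorphism, which are given on R₃ only, applicable to it.
  InR-orbit : ∀ f j → InR 3 (λ k → lookup f (k · j))
  InR-orbit f j = InR-weaken 2 (InR-cong (λ k → ΣF-eqF′ N (k · j) (lookup f))
    (InR-ΣF N (λ u → InR-∧const (lookup f u) (InR-gen u j))))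

  pull-injective : ∀ ψ φ → (∀ r → InR 3 r → comp3 ψ φ r ≡ ε3 r) → Injective _≡_ _≡_ (pull ψ)
  pull-injective ψ φ inverse {f} {f′} e = trans (sym (retract f)) (trans (cong (pull φ) e) (retract f′))
    where
    retract : ∀ f → pull φ (pull ψ f) ≡ f
    retract f = lookup-ext λ j → trans (sym (comp3-eval ψ φ f j)) (trans (inverse _ (InR-orbit f j)) (ε3-eval f j))

  module _ (A A′ : Vec Bool (dim Vrep)) (ψ : R) (hom : Hom3 Vrep (λ v → v ≡ A′) (λ v → v ≡ A) ψ) where

    -- The generator f(g A′) − f(A) lies in R₂, so its multiples by matrix coefficients g_{u,i} ∈ R₁ stay in the ideal.
    hom-entry : ∀ k u i → sumG (λ g → ψ g ∧ ((lookup A′ (_∙_ VrepA (inv g) k) xor lookup A k) ∧ eqF (g · i) u)) ≡ false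
    hom-entry k u i = hom _ (mul 2 (s≤s (s≤s z≤n)) (base (inj₁ (unit k , A′ , A , refl , refl , (λ x e → cong (dot (unit k)) e) ,
        λ g → sym (cong₂ _xor_ (trans (dot-unit (act Vrep g A′)) (lookup-act VrepA g A′ k)) (dot-unit A)))))
        (InR-xor (InR-cong (λ g → trans (sym (lookup∘tabulate _ k)) (lookup-act VrepA g A′ k))
                           (InR-ΣF (dim Vrep) (λ j → InR-∧const (lookup A′ j) (LevelLE-Vrep k j))))
                 (InR-const 2 (lookup A k)))
        (InR-gen u i))
      where
      dot-unit : ∀ v → dot (unit k) v ≡ lookup v k
      dot-unit v = trans (ΣF-cong (dim Vrep) (λ j → cong (_∧ lookup v j) (lookup∘tabulate _ j))) (ΣF-eqF (dim Vrep) k (lookup v))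

    private
      adjA adjA′ : Fin N → Fin N → Bool
      adjA  i j = lookup A  (edgeIx (combine i j))
      adjA′ i j = lookup A′ (edgeIx (combine i j))
      colA colA′ : Fin N → Bool
      colA  i = lookup A  (colIx i)
      colA′ i = lookup A′ (colIx i)

    -- Here `u` is fixed, whereas `pull-adj` needs the row g · i, which varies with g. The factor
    -- [g · i = u] followed by a sum over `u` puts g · i in its place.
    adj-entry : ∀ u v i → sumG (λ g → ψ g ∧ ((adjA′ (lookup (bwd g) u) (lookup (bwd g) v) xor adjA u v) ∧ eqF (g · i) u)) ≡ false
    adj-entry u v i = trans
      (sumL-cong allG (λ g → cong (λ x → ψ g ∧ ((lookup A′ x xor adjA u v) ∧ eqF (g · i) u))
        (sym (trans (edgeIx-∙ (inv g) (combine u v)) (cong edgeIx (⊗∙-combine permA permA (inv g) u v))))))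
      (hom-entry (edgeIx (combine u v)) u i)

    col-entry : ∀ u i → sumG (λ g → ψ g ∧ ((colA′ (lookup (bwd g) u) xor colA u) ∧ eqF (g · i) u)) ≡ false
    col-entry u i = trans
      (sumL-cong allG (λ g → cong (λ x → ψ g ∧ ((lookup A′ x xor colA u) ∧ eqF (g · i) u)) (sym (colIx-∙ (inv g) u))))
      (hom-entry (colIx u) u i)

    sumG-ΣF : ∀ n (c : Fin n → Bool) (X : G → Fin n → Bool) →
      sumG (λ g → ψ g ∧ ΣF n (λ v → c v ∧ X g v)) ≡ ΣF n (λ v → c v ∧ sumG (λ g → ψ g ∧ X g v))
    sumG-ΣF n c X = begin
      sumG (λ g → ψ g ∧ ΣF n (λ v → c v ∧ X g v))
        ≡⟨ sumL-cong allG (λ g → trans (∧-ΣF n (ψ g) _) (ΣF-cong n (λ v → ∧-swap (ψ g) (c v) (X g v)))) ⟩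
      sumG (λ g → ΣF n (λ v → c v ∧ (ψ g ∧ X g v)))
        ≡⟨ sumL-ΣF n (λ g v → c v ∧ (ψ g ∧ X g v)) allG ⟩
      ΣF n (λ v → sumG (λ g → c v ∧ (ψ g ∧ X g v)))
        ≡⟨ ΣF-cong n (λ v → sym (∧-sumL (c v) (λ g → ψ g ∧ X g v) allG)) ⟩
      ΣF n (λ v → c v ∧ sumG (λ g → ψ g ∧ X g v)) ∎
      where open ≡-Reasoning

    sumG-vanish : ∀ n (c : Fin n → Bool) (X : G → Fin n → Bool) → (∀ v → sumG (λ g → ψ g ∧ X g v) ≡ false) →
      sumG (λ g → ψ g ∧ ΣF n (λ v → c v ∧ X g v)) ≡ false
    sumG-vanish n c X e = trans (sumG-ΣF n c X) (ΣF-false n (λ v → trans (cong (c v ∧_) (e v)) (∧-zeroʳ (c v))))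

    sumG-difference : ∀ (X Y : R) → sumG (λ g → ψ g ∧ (X g xor Y g)) ≡ false → sumG (λ g → ψ g ∧ X g) ≡ sumG (λ g → ψ g ∧ Y g)
    sumG-difference X Y e = xor≡false⇒≡ _ _ (trans
      (sym (trans (sumL-cong allG (λ g → ∧-distribˡ-xor (ψ g) (X g) (Y g))) (sumL-xor (λ g → ψ g ∧ X g) (λ g → ψ g ∧ Y g) allG))) e)

    ΣF-select : ∀ (F : Fin N → Bool) k → ΣF N (λ u → F u ∧ eqF k u) ≡ F k
    ΣF-select F k = trans (ΣF-cong N (λ u → ∧-comm (F u) (eqF k u))) (ΣF-eqF′ N k F)

    -- After the substitution v = g · j the difference of the two sides is the sum of the relations
    -- `adj-entry` over u and v with weights f(v). Hence `pull ψ` intertwines the two adjacency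
    -- matrices.
    pull-adj : ∀ f i → ΣF N (λ j → adjA′ i j ∧ lookup (pull ψ f) j) ≡ sumG (λ g → ψ g ∧ ΣF N (λ v → adjA (g · i) v ∧ lookup f v))
    pull-adj f i = begin
      ΣF N (λ j → adjA′ i j ∧ lookup (pull ψ f) j)
        ≡⟨ ΣF-cong N (λ j → cong (adjA′ i j ∧_) (lookup∘tabulate _ j)) ⟩
      ΣF N (λ j → adjA′ i j ∧ sumG (λ g → ψ g ∧ lookup f (g · j)))
        ≡⟨ sym (sumG-ΣF N (adjA′ i) (λ g j → lookup f (g · j))) ⟩
      sumG (λ g → ψ g ∧ ΣF N (λ j → adjA′ i j ∧ lookup f (g · j)))
        ≡⟨ sumG-difference (λ g → ΣF N (λ j → adjA′ i j ∧ lookup f (g · j))) (λ g → ΣF N (λ v → adjA (g · i) v ∧ lookup f v))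
             (trans (sumL-cong allG (λ g → cong (ψ g ∧_) (expand g)))
               (sumG-vanish N (lookup f) _ (λ v → sumG-vanish N (λ _ → true) _ (λ u → adj-entry u v i)))) ⟩
      sumG (λ g → ψ g ∧ ΣF N (λ v → adjA (g · i) v ∧ lookup f v)) ∎
      where
      open ≡-Reasoning
      expand : ∀ g → ΣF N (λ j → adjA′ i j ∧ lookup f (g · j)) xor ΣF N (λ v → adjA (g · i) v ∧ lookup f v)
        ≡ ΣF N (λ v → lookup f v ∧ ΣF N (λ u → (adjA′ (lookup (bwd g) u) (lookup (bwd g) v) xor adjA u v) ∧ eqF (g · i) u))
      expand g = begin
        ΣF N (λ j → adjA′ i j ∧ lookup f (g · j)) xor ΣF N (λ v → adjA (g · i) v ∧ lookup f v)
          ≡⟨ cong (_xor ΣF N (λ v → adjA (g · i) v ∧ lookup f v)) (trans (ΣF-cong N (λ j → cong (λ x → adjA′ i x ∧ lookup f (g · j)) (sym (bwd-fwd g j))))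
               (ΣF-reindex N (g ·_) (lookup (bwd g)) (fwd-bwd g) (bwd-fwd g) (λ v → adjA′ i (lookup (bwd g) v) ∧ lookup f v))) ⟩
        ΣF N (λ v → adjA′ i (lookup (bwd g) v) ∧ lookup f v) xor ΣF N (λ v → adjA (g · i) v ∧ lookup f v)
          ≡⟨ sym (ΣF-xor N _ _) ⟩
        ΣF N (λ v → (adjA′ i (lookup (bwd g) v) ∧ lookup f v) xor (adjA (g · i) v ∧ lookup f v))
          ≡⟨ ΣF-cong N (λ v → trans (sym (∧-distribʳ-xor (lookup f v) (adjA′ i (lookup (bwd g) v)) _)) (∧-comm _ (lookup f v))) ⟩
        ΣF N (λ v → lookup f v ∧ (adjA′ i (lookup (bwd g) v) xor adjA (g · i) v))
          ≡⟨ ΣF-cong N (λ v → cong (lookup f v ∧_) (sym (trans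
               (ΣF-select (λ u → adjA′ (lookup (bwd g) u) (lookup (bwd g) v) xor adjA u v) (g · i))
               (cong (λ x → adjA′ x (lookup (bwd g) v) xor adjA (g · i) v) (bwd-fwd g i))))) ⟩
        _ ∎

    -- The same argument for the colour indicator. It is what lets `pull ψ` preserve vanishing on
    -- X₁.
    pull-col : ∀ f i → colA′ i ∧ lookup (pull ψ f) i ≡ sumG (λ g → ψ g ∧ (colA (g · i) ∧ lookup f (g · i)))
    pull-col f i = begin
      colA′ i ∧ lookup (pull ψ f) i
        ≡⟨ cong (colA′ i ∧_) (lookup∘tabulate _ i) ⟩
      colA′ i ∧ sumG (λ g → ψ g ∧ lookup f (g · i))
        ≡⟨ ∧-sumL (colA′ i) (λ g → ψ g ∧ lookup f (g · i)) allG ⟩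
      sumG (λ g → colA′ i ∧ (ψ g ∧ lookup f (g · i)))
        ≡⟨ sumL-cong allG (λ g → ∧-swap (colA′ i) (ψ g) _) ⟩
      sumG (λ g → ψ g ∧ (colA′ i ∧ lookup f (g · i)))
        ≡⟨ sumG-difference (λ g → colA′ i ∧ lookup f (g · i)) (λ g → colA (g · i) ∧ lookup f (g · i))
             (trans (sumL-cong allG (λ g → cong (ψ g ∧_) (expand g))) (sumG-vanish N (lookup f) _ (λ u → col-entry u i))) ⟩
      sumG (λ g → ψ g ∧ (colA (g · i) ∧ lookup f (g · i))) ∎
      where
      open ≡-Reasoning
      expand : ∀ g → (colA′ i ∧ lookup f (g · i)) xor (colA (g · i) ∧ lookup f (g · i))
        ≡ ΣF N (λ u → lookup f u ∧ ((colA′ (lookup (bwd g) u) xor colA u) ∧ eqF (g · i) u))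
      expand g = begin
        (colA′ i ∧ lookup f (g · i)) xor (colA (g · i) ∧ lookup f (g · i))
          ≡⟨ sym (∧-distribʳ-xor (lookup f (g · i)) (colA′ i) _) ⟩
        (colA′ i xor colA (g · i)) ∧ lookup f (g · i)
          ≡⟨ ∧-comm _ (lookup f (g · i)) ⟩
        lookup f (g · i) ∧ (colA′ i xor colA (g · i))
          ≡⟨ cong (λ x → lookup f (g · i) ∧ (colA′ x xor colA (g · i))) (sym (bwd-fwd g i)) ⟩
        lookup f (g · i) ∧ (colA′ (lookup (bwd g) (g · i)) xor colA (g · i))
          ≡⟨ sym (ΣF-select (λ u → lookup f u ∧ (colA′ (lookup (bwd g) u) xor colA u)) (g · i)) ⟩
        ΣF N (λ u → (lookup f u ∧ (colA′ (lookup (bwd g) u) xor colA u)) ∧ eqF (g · i) u)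
          ≡⟨ ΣF-cong N (λ u → ∧-assoc (lookup f u) _ _) ⟩
        _ ∎

-- The linear system on the two CFI graphs

onlyIf : (p : Bool) → (T p → Bool) → Bool
onlyIf true  k = k tt
onlyIf false k = false

onlyIf-yes : ∀ {p} k (t : T p) → onlyIf p k ≡ k t
onlyIf-yes {true} k tt = refl

onlyIf-no : ∀ {p} k → ¬ T p → onlyIf p k ≡ false
onlyIf-no {true}  k ¬t = ⊥-elim (¬t tt)
onlyIf-no {false} k ¬t = refl

onlyIf-xor : ∀ p k k′ → onlyIf p (λ t → k t xor k′ t) ≡ onlyIf p k xor onlyIf p k′
onlyIf-xor true  k k′ = refl
onlyIf-xor false k k′ = refl

onlyIf-cong : ∀ p {k k′} → (∀ t → k t ≡ k′ t) → onlyIf p k ≡ onlyIf p k′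
onlyIf-cong true  e = e tt
onlyIf-cong false e = refl

≢⇒xor≡true : ∀ p q → p ≢ q → p xor q ≡ true
≢⇒xor≡true true  true  ne = contradiction refl ne
≢⇒xor≡true true  false ne = refl
≢⇒xor≡true false true  ne = refl
≢⇒xor≡true false false ne = contradiction refl ne

≢not⇒xor≡false : ∀ p q → p ≢ not q → p xor q ≡ false
≢not⇒xor≡false true  true  ne = refl
≢not⇒xor≡false true  false ne = contradiction refl ne
≢not⇒xor≡false false true  ne = contradiction refl ne
≢not⇒xor≡false false false ne = refl

module CFISolutions (n : ℕ) (adj : Fin n → Fin n → Bool)
  (adj-sym : ∀ x y → adj x y ≡ adj y x) (adj-irrefl : ∀ x → adj x x ≡ false)
  (x~ y~ : Fin n) (x~y~ : T (adj x~ y~)) (N : ℕ) (π : CFIV.Vtx n adj ↔ Fin N) where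
  open CFIV n adj
  open CFI n adj x~ y~
  open CFIA n adj x~ y~ N π

  to : Vtx → Fin N
  to = Inverse.to π

  to-lab : ∀ i → to (lab i) ≡ i
  to-lab = Inverse.strictlyInverseˡ π

  lab-to : ∀ v → lab (to v) ≡ v
  lab-to = Inverse.strictlyInverseʳ π

  flipT : ∀ {x y} → T (adj x y) → T (adj y x)
  flipT {x} {y} = subst T (adj-sym x y)

  ΣV-single : (K : Vtx → Bool) (w : Vtx) → (∀ v → v ≢ w → K v ≡ false) → ΣF N (K ∘ lab) ≡ K w
  ΣV-single K w e = trans
    (ΣF-single N (K ∘ lab) (to w) (λ i i≢ → e (lab i) (λ l → i≢ (trans (sym (to-lab i)) (cong to l)))))
    (cong K (lab-to w))

  -- Indexing a and b by a bit turns a twist into an xor on that bit, which allows one treatment of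
  -- both graphs.
  side : Bool → (x y : Fin n) → T (adj x y) → Vtx
  side false = a
  side true  = b

  side-cong : ∀ {s s′ x x′ y y′} p p′ → s ≡ s′ → x ≡ x′ → y ≡ y′ → side s x y p ≡ side s′ x′ y′ p′
  side-cong p p′ refl refl refl = cong (side _ _ _) (T-irrelevant p p′)

  data View : Vtx → Set where
    isC    : ∀ x Y p q → View (c x Y p q)
    isSide : ∀ s x y p → View (side s x y p)

  view : ∀ v → View v
  view (c x Y p q) = isC x Y p q
  view (a x y p)   = isSide false x y p
  view (b x y p)   = isSide true x y p

  -- A common form of the two edge relations: τ marks the twisted edges of the base graph.
  record EdgeSpec (τ : Fin n → Fin n → Bool) (E : Vtx → Vtx → Bool) : Set where
    field
      cc : ∀ x Y p q x′ Y′ p′ q′ → E (c x Y p q) (c x′ Y′ p′ q′) ≡ false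
      cs : ∀ x Y p q s x′ y′ p′ → E (c x Y p q) (side s x′ y′ p′) ≡ eqF x′ x ∧ (s xor lookup Y y′)
      ss : ∀ s x y p s′ x′ y′ p′ → E (side s x y p) (side s′ x′ y′ p′) ≡ (eqF x′ y ∧ eqF y′ x) ∧ not ((s xor τ x y) xor s′)

  untwisted : Fin n → Fin n → Bool
  untwisted _ _ = false

  tilde-sym : ∀ x y → tilde x y ≡ tilde y x
  tilde-sym x y = trans (∨-comm (eqF x x~ ∧ eqF y y~) _)
    (cong₂ _∨_ (∧-comm (eqF x y~) (eqF y x~)) (∧-comm (eqF x x~) (eqF y y~)))

  -- The edge relation is the symmetrisation of an oriented one. This rewrites the reversed disjunct
  -- as the forward one, with κ = `not` for the a-a and b-b edges and κ = `id` for the a-b edges.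
  reverse-edge : ∀ (κ : Bool → Bool) x y x′ y′ →
    eqF x y′ ∧ eqF y x′ ∧ κ (tilde x′ y′) ≡ (eqF x′ y ∧ eqF y′ x) ∧ κ (tilde x y)
  reverse-edge κ x y x′ y′ with x′ ≟ y | y′ ≟ x
  ... | yes refl | yes refl rewrite eqF-refl x | eqF-refl y = cong κ (tilde-sym y x)
  ... | yes refl | no y′≢x  rewrite ≢⇒eqF {i = x} {y′} (y′≢x ∘ sym) = refl
  ... | no x′≢y  | _        rewrite ≢⇒eqF {i = y} {x′} (x′≢y ∘ sym) = ∧-zeroʳ (eqF x y′)

  Eg-spec : EdgeSpec untwisted Eg
  Eg-spec = record
    { cc = λ _ _ _ _ _ _ _ _ → refl
    ; cs = λ { x Y p q false x′ y′ p′ → refl ; x Y p q true x′ y′ p′ → refl }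
    ; ss = λ { false x y p false x′ y′ p′ → both x y x′ y′
             ; false x y p true  x′ y′ p′ → sym (∧-zeroʳ _)
             ; true  x y p false x′ y′ p′ → sym (∧-zeroʳ _)
             ; true  x y p true  x′ y′ p′ → both x y x′ y′ } }
    where
    both : ∀ x y x′ y′ → (eqF x′ y ∧ eqF y′ x) ∨ (eqF x y′ ∧ eqF y x′) ≡ (eqF x′ y ∧ eqF y′ x) ∧ true
    both x y x′ y′ = trans
      (cong ((eqF x′ y ∧ eqF y′ x) ∨_) (trans (cong₂ _∧_ (eqF-sym x y′) (eqF-sym y x′)) (∧-comm (eqF y′ x) (eqF x′ y))))
      (trans (∨-idem _) (sym (∧-identityʳ _)))

  Eg′-spec : EdgeSpec tilde Eg'
  Eg′-spec = record
    { cc = λ _ _ _ _ _ _ _ _ → refl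
    ; cs = λ { x Y p q false x′ y′ p′ → refl ; x Y p q true x′ y′ p′ → refl }
    ; ss = λ { false x y p false x′ y′ p′ → trans (both x y x′ y′) (cong (λ t → (eqF x′ y ∧ eqF y′ x) ∧ not t) (sym (xor-identityʳ (tilde x y))))
             ; false x y p true  x′ y′ p′ → trans (∨-identityʳ _) (trans (sym (∧-assoc (eqF x′ y) _ _)) (cong ((eqF x′ y ∧ eqF y′ x) ∧_) (not-xor-true (tilde x y))))
             ; true  x y p false x′ y′ p′ → trans (reverse-edge id x y x′ y′) (cong ((eqF x′ y ∧ eqF y′ x) ∧_) (not-not-xor-false (tilde x y)))
             ; true  x y p true  x′ y′ p′ → trans (both x y x′ y′) (cong ((eqF x′ y ∧ eqF y′ x) ∧_) (not-not-xor-true (tilde x y))) } }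
    where
    both : ∀ x y x′ y′ → (eqF x′ y ∧ eqF y′ x ∧ not (tilde x y)) ∨ (eqF x y′ ∧ eqF y x′ ∧ not (tilde x′ y′)) ≡ (eqF x′ y ∧ eqF y′ x) ∧ not (tilde x y)
    both x y x′ y′ = trans (cong₂ _∨_ (sym (∧-assoc (eqF x′ y) _ _)) (reverse-edge not x y x′ y′)) (∨-idem _)
    not-xor-true : ∀ t → t ≡ not (t xor true)
    not-xor-true false = refl
    not-xor-true true  = refl
    not-not-xor-false : ∀ t → t ≡ not (not t xor false)
    not-not-xor-false false = refl
    not-not-xor-false true  = refl
    not-not-xor-true : ∀ t → not t ≡ not (not t xor true)
    not-not-xor-true false = refl
    not-not-xor-true true  = refl

  -- The equations of `Sol` vertex by vertex. Over the edge {x, y} the neighbour of c_{x,Y} has side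
  -- `not (lookup Y y)`, since `false` stands for a, and a is joined to c exactly when y ∈ Y.
  record Local (τ : Fin n → Fin n → Bool) (φ : Vtx → Bool) : Set where
    field
      on-c    : ∀ x Y p q → φ (c x Y p q) ≡ false
      on-edge : ∀ s x y p q → φ (side (s xor τ x y) y x q) ≡ φ (side s x y p)
      at-c    : ∀ x Y → T (subNbr x Y) → T (not (oddB (count Y))) →
                ΣF n (λ y → onlyIf (adj x y) (λ r → φ (side (not (lookup Y y)) x y r))) ≡ false
  open Local

  module _ {τ E} (spec : EdgeSpec τ E) (φ : Vtx → Bool) where
    open EdgeSpec spec

    -- Neighbours in X₁ contribute 0 and the edges inside X₂ form a perfect matching, so only the
    -- opposite end remains, its side changed by the twist.
    sum-at-side : (∀ x Y p q → φ (c x Y p q) ≡ false) → ∀ s x y p q →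
      ΣF N (λ j → E (side s x y p) (lab j) ∧ φ (lab j)) ≡ φ (side (s xor τ x y) y x q)
    sum-at-side φc s x y p q = trans
      (ΣV-single (λ v → E (side s x y p) v ∧ φ v) w (λ v v≢w → vanish v (view v) v≢w))
      (cong (_∧ φ w) (trans (ss s x y p (s xor τ x y) y x q) (cong₂ _∧_ (cong₂ _∧_ (eqF-refl y) (eqF-refl x)) (cong not (xor-same (s xor τ x y))))))
      where
      w = side (s xor τ x y) y x q
      vanish : ∀ v → View v → v ≢ w → E (side s x y p) v ∧ φ v ≡ false
      vanish _ (isC x′ Y p′ q′) _ = trans (cong (E (side s x y p) (c x′ Y p′ q′) ∧_) (φc x′ Y p′ q′)) (∧-zeroʳ _)
      vanish _ (isSide s′ x′ y′ p′) v≢w = cong (_∧ φ (side s′ x′ y′ p′)) (trans (ss s x y p s′ x′ y′ p′) off)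
        where
        off : (eqF x′ y ∧ eqF y′ x) ∧ not ((s xor τ x y) xor s′) ≡ false
        off with x′ ≟ y | y′ ≟ x | (s xor τ x y) Bool.≟ s′
        ... | yes e | yes e′ | yes e″ = contradiction (side-cong p′ q (sym e″) e e′) v≢w
        ... | yes _ | yes _  | no ≢s′ = cong not (≢⇒xor≡true _ _ ≢s′)
        ... | yes _ | no _   | _      = refl
        ... | no _  | _      | _      = refl

    -- Each edge at x carries exactly one neighbour of c_{x,Y}. Writing adjacency as a sum over y of
    -- the tests `mem y` allows the sums over vertices and over y to be exchanged.
    sum-at-c : ∀ x Y p q → ΣF N (λ j → E (c x Y p q) (lab j) ∧ φ (lab j))
      ≡ ΣF n (λ y → onlyIf (adj x y) (λ r → φ (side (not (lookup Y y)) x y r)))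
    sum-at-c x Y p q = begin
      ΣF N (λ j → E (c x Y p q) (lab j) ∧ φ (lab j))
        ≡⟨ ΣF-cong N (λ j → trans (cong (_∧ φ (lab j)) (E-mem (lab j) (view (lab j)))) (ΣF-∧ n (λ y → mem y (lab j)) (φ (lab j)))) ⟩
      ΣF N (λ j → ΣF n (λ y → mem y (lab j) ∧ φ (lab j)))
        ≡⟨ ΣF-swap N n _ ⟩
      ΣF n (λ y → ΣF N (λ j → mem y (lab j) ∧ φ (lab j)))
        ≡⟨ ΣF-cong n pick ⟩
      ΣF n (λ y → onlyIf (adj x y) (λ r → φ (side (not (lookup Y y)) x y r))) ∎
      where
      open ≡-Reasoning
      is-neighbour : Fin n → Bool → Fin n → Fin n → Bool
      is-neighbour y s x′ y′ = eqF x′ x ∧ (eqF y′ y ∧ (s xor lookup Y y))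
      mem : Fin n → Vtx → Bool
      mem y (c _ _ _ _) = false
      mem y (a x′ y′ _) = is-neighbour y false x′ y′
      mem y (b x′ y′ _) = is-neighbour y true x′ y′
      mem-side : ∀ y s x′ y′ p′ → mem y (side s x′ y′ p′) ≡ is-neighbour y s x′ y′
      mem-side y false _ _ _ = refl
      mem-side y true  _ _ _ = refl
      E-mem : ∀ v → View v → E (c x Y p q) v ≡ ΣF n (λ y → mem y v)
      E-mem _ (isC x′ Y′ p′ q′) = trans (cc x Y p q x′ Y′ p′ q′) (sym (ΣF-false n (λ _ → refl)))
      E-mem _ (isSide s x′ y′ p′) = trans (cs x Y p q s x′ y′ p′) (sym (begin
        ΣF n (λ y → mem y (side s x′ y′ p′))                               ≡⟨ ΣF-cong n (λ y → mem-side y s x′ y′ p′) ⟩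
        ΣF n (λ y → eqF x′ x ∧ (eqF y′ y ∧ (s xor lookup Y y)))            ≡⟨ sym (∧-ΣF n (eqF x′ x) _) ⟩
        eqF x′ x ∧ ΣF n (λ y → eqF y′ y ∧ (s xor lookup Y y))              ≡⟨ cong (eqF x′ x ∧_) (ΣF-eqF′ n y′ (λ y → s xor lookup Y y)) ⟩
        eqF x′ x ∧ (s xor lookup Y y′)                                     ∎))
      not-xor : ∀ t → not t xor t ≡ true
      not-xor false = refl
      not-xor true  = refl
      off : ∀ y s x′ y′ → (x′ ≡ x → y′ ≡ y → s ≢ not (lookup Y y)) → is-neighbour y s x′ y′ ≡ false
      off y s x′ y′ ne with x′ ≟ x | y′ ≟ y
      ... | no _  | _     = refl
      ... | yes _ | no _  = refl
      ... | yes e | yes e′ = ≢not⇒xor≡false s (lookup Y y) (ne e e′)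
      pick : ∀ y → ΣF N (λ j → mem y (lab j) ∧ φ (lab j)) ≡ onlyIf (adj x y) (λ r → φ (side (not (lookup Y y)) x y r))
      pick y with T? (adj x y)
      ... | yes r = trans (trans
          (ΣV-single (λ v → mem y v ∧ φ v) w (λ v v≢w → vanish v (view v) v≢w))
          (cong (_∧ φ w) (trans (mem-side y (not (lookup Y y)) x y r) (cong₂ _∧_ (eqF-refl x) (cong₂ _∧_ (eqF-refl y) (not-xor (lookup Y y)))))))
          (sym (onlyIf-yes (λ r → φ (side (not (lookup Y y)) x y r)) r))
        where
        w = side (not (lookup Y y)) x y r
        vanish : ∀ v → View v → v ≢ w → mem y v ∧ φ v ≡ false
        vanish _ (isC _ _ _ _) _ = refl
        vanish _ (isSide s x′ y′ p′) v≢w = cong (_∧ _) (trans (mem-side y s x′ y′ p′)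
          (off y s x′ y′ (λ e e′ e″ → v≢w (side-cong p′ r e″ e e′))))
      ... | no ¬r = trans (ΣF-false N (λ j → vanish (lab j) (view (lab j)))) (sym (onlyIf-no _ ¬r))
        where
        vanish : ∀ v → View v → mem y v ∧ φ v ≡ false
        vanish _ (isC _ _ _ _) = refl
        vanish _ (isSide s x′ y′ p′) = cong (_∧ _) (trans (mem-side y s x′ y′ p′)
          (off y s x′ y′ (λ { refl refl _ → ¬r p′ })))

  Sol : (Vtx → Vtx → Bool) → Subset N
  Sol E f = ∀ i → (ΣF N (λ j → E (lab i) (lab j) ∧ lookup f j) ≡ lookup f i) × (isX1 (lab i) ∧ lookup f i ≡ false)

  value : Vec Bool N → Vtx → Bool
  value f v = lookup f (to v)

  isX1-side : ∀ s x y p → isX1 (side s x y p) ≡ false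
  isX1-side false _ _ _ = refl
  isX1-side true  _ _ _ = refl

  module _ {τ E} (spec : EdgeSpec τ E) where

    Sol⇒Local : ∀ f → Sol E f → Local τ (value f)
    Sol⇒Local f S = record
      { on-c    = zeroC
      ; on-edge = λ s x y p q → trans (sym (sum-at-side spec (value f) zeroC s x y p q)) (row (side s x y p))
      ; at-c    = λ x Y p q → trans (sym (sum-at-c spec (value f) x Y p q)) (trans (row (c x Y p q)) (zeroC x Y p q))
      }
      where
      row : ∀ v → ΣF N (λ j → E v (lab j) ∧ value f (lab j)) ≡ value f v
      row v = trans (ΣF-cong N (λ j → cong₂ (λ w k → E w (lab j) ∧ lookup f k) (sym (lab-to v)) (to-lab j))) (proj₁ (S (to v)))
      zeroC : ∀ x Y p q → value f (c x Y p q) ≡ false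
      zeroC x Y p q = trans (cong (λ v → isX1 v ∧ value f (c x Y p q)) (sym (lab-to (c x Y p q)))) (proj₂ (S (to (c x Y p q))))

    Local⇒Sol : ∀ f φ → (∀ i → lookup f i ≡ φ (lab i)) → Local τ φ → Sol E f
    Local⇒Sol f φ f≡φ L i =
      trans (ΣF-cong N (λ j → cong (E (lab i) (lab j) ∧_) (f≡φ j))) (trans (row (lab i) (view (lab i))) (sym (f≡φ i))) ,
      trans (cong (isX1 (lab i) ∧_) (f≡φ i)) (colour (lab i) (view (lab i)))
      where
      row : ∀ v → View v → ΣF N (λ j → E v (lab j) ∧ φ (lab j)) ≡ φ v
      row _ (isC x Y p q)    = trans (sum-at-c spec φ x Y p q) (trans (at-c L x Y p q) (sym (on-c L x Y p q)))
      row _ (isSide s x y p) = trans (sum-at-side spec φ (on-c L) s x y p (flipT p)) (on-edge L s x y p (flipT p))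
      colour : ∀ v → View v → isX1 v ∧ φ v ≡ false
      colour _ (isC x Y p q)    = on-c L x Y p q
      colour _ (isSide s x y p) = cong (_∧ φ (side s x y p)) (isX1-side s x y p)

  -- The value 0 at nonadjacent pairs lets all sums range over `Fin n` and makes `δ` vanish off the
  -- edges.
  ends : (Vtx → Bool) → Bool → Fin n → Fin n → Bool
  ends φ s x y = onlyIf (adj x y) (λ r → φ (side s x y r))

  δ : (Vtx → Bool) → Fin n → Fin n → Bool
  δ φ x y = ends φ false x y xor ends φ true x y

  ends-δ : ∀ φ s t x y → ends φ (s xor t) x y ≡ ends φ s x y xor (t ∧ δ φ x y)
  ends-δ φ s     false x y = trans (cong (λ u → ends φ u x y) (xor-identityʳ s)) (sym (xor-identityʳ _))
  ends-δ φ false true  x y = sym (xor-cancelˡ (ends φ false x y) _)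
  ends-δ φ true  true  x y = sym (trans (cong (ends φ true x y xor_) (xor-comm (ends φ false x y) _)) (xor-cancelˡ (ends φ true x y) _))

  ends-edge : ∀ {τ φ} → Local τ φ → ∀ s x y → ends φ (s xor τ x y) y x ≡ ends φ s x y
  ends-edge {τ} {φ} L s x y with T? (adj x y)
  ... | yes p = trans (onlyIf-yes _ (flipT p)) (trans (on-edge L s x y p (flipT p)) (sym (onlyIf-yes _ p)))
  ... | no ¬p = trans (onlyIf-no _ (¬p ∘ flipT)) (sym (onlyIf-no _ ¬p))

  -- A twist only exchanges the two values at the other end, which leaves their sum unchanged.
  δ-sym : ∀ {τ φ} → Local τ φ → ∀ x y → δ φ y x ≡ δ φ x y
  δ-sym {τ} {φ} L x y with τ x y | ends-edge L false x y | ends-edge L true x y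
  ... | false | e | e′ = cong₂ _xor_ e e′
  ... | true  | e | e′ = trans (cong₂ _xor_ e′ e) (xor-comm (ends φ true x y) _)

  ends-reverse : ∀ {τ φ} → Local τ φ → ∀ x y → ends φ true y x ≡ ends φ true x y xor (τ x y ∧ δ φ x y)
  ends-reverse {τ} {φ} L x y = begin
    ends φ true y x                                     ≡⟨ sym (xor-cancelʳ _ (τ x y ∧ δ φ y x)) ⟩
    (ends φ true y x xor (τ x y ∧ δ φ y x)) xor (τ x y ∧ δ φ y x)
      ≡⟨ cong₂ _xor_ (sym (ends-δ φ true (τ x y) y x)) (cong (τ x y ∧_) (δ-sym L x y)) ⟩
    ends φ (true xor τ x y) y x xor (τ x y ∧ δ φ x y)   ≡⟨ cong (_xor (τ x y ∧ δ φ x y)) (ends-edge L true x y) ⟩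
    ends φ true x y xor (τ x y ∧ δ φ x y)               ∎
    where
    open ≡-Reasoning
    xor-cancelʳ : ∀ p q → (p xor q) xor q ≡ p
    xor-cancelʳ p q = trans (xor-assoc p q q) (trans (cong (p xor_) (xor-same q)) (xor-identityʳ p))

  -- Parity and the twisted edge

  oddB-count : ∀ {m} (Y : Vec Bool m) → oddB (count Y) ≡ ΣF m (lookup Y)
  oddB-count []          = refl
  oddB-count (true ∷ Y)  = cong not (oddB-count Y)
  oddB-count (false ∷ Y) = oddB-count Y

  subNbr-intro : ∀ x Y → (∀ z → lookup Y z ≡ true → T (adj x z)) → T (subNbr x Y)
  subNbr-intro x Y h = ≡⇒T (∀⇒allF n _ λ z → imp (lookup Y z) (adj x z) (h z))
    where
    imp : ∀ p q → (p ≡ true → T q) → not p ∨ q ≡ true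
    imp false q h = refl
    imp true  q h = Equivalence.to T-≡ (h refl)

  subNbr-elim : ∀ x Y → T (subNbr x Y) → ∀ z → lookup Y z ≡ true → T (adj x z)
  subNbr-elim x Y t z e = ≡⇒T (trans (sym (cong (λ p → not p ∨ adj x z) e)) (allF⇒∀ n _ t z))

  module _ {τ φ} (L : Local τ φ) where

    -- This is the condition at c_{x,∅}, whose neighbours are the b-vertices at x.
    sum-ends-true : ∀ x → ΣF n (ends φ true x) ≡ false
    sum-ends-true x = trans
      (ΣF-cong n (λ y → cong (λ t → ends φ (not t) x y) (sym (lookup-0ᵥ y))))
      (at-c L x 0ᵥ (subNbr-intro x 0ᵥ (λ z e → ⊥-elim (true≢false (trans (sym e) (lookup-0ᵥ z)))))
        (Equivalence.from T-not-≡ (trans (oddB-count (0ᵥ {n})) (ΣF-false n lookup-0ᵥ))))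

    -- The difference of the conditions at c_{x,Y} and c_{x,∅}: passing from ∅ to Y replaces b by a
    -- over the edges in Y.
    sum-δ : ∀ x Y → T (subNbr x Y) → T (not (oddB (count Y))) → ΣF n (λ y → lookup Y y ∧ δ φ x y) ≡ false
    sum-δ x Y p q = begin
      ΣF n (λ y → lookup Y y ∧ δ φ x y)
        ≡⟨ cong (_xor ΣF n (λ y → lookup Y y ∧ δ φ x y)) (sym (sum-ends-true x)) ⟩
      ΣF n (ends φ true x) xor ΣF n (λ y → lookup Y y ∧ δ φ x y)
        ≡⟨ sym (ΣF-xor n _ _) ⟩
      ΣF n (λ y → ends φ true x y xor (lookup Y y ∧ δ φ x y))
        ≡⟨ ΣF-cong n (λ y → sym (ends-δ φ true (lookup Y y) x y)) ⟩
      ΣF n (λ y → ends φ (not (lookup Y y)) x y)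
        ≡⟨ at-c L x Y p q ⟩
      false ∎
      where open ≡-Reasoning

    -- Comparing c_{x,∅} with c_{x,{y,z}}.
    δ-constant : ∀ x y z → T (adj x y) → T (adj x z) → δ φ x y ≡ δ φ x z
    δ-constant x y z p q = xor≡false⇒≡ _ _ (begin
      δ φ x y xor δ φ x z
        ≡⟨ sym (cong₂ _xor_ (ΣF-eqF n y (δ φ x)) (ΣF-eqF n z (δ φ x))) ⟩
      ΣF n (λ w → eqF w y ∧ δ φ x w) xor ΣF n (λ w → eqF w z ∧ δ φ x w)
        ≡⟨ sym (ΣF-xor n _ _) ⟩
      ΣF n (λ w → (eqF w y ∧ δ φ x w) xor (eqF w z ∧ δ φ x w))
        ≡⟨ ΣF-cong n (λ w → trans (sym (∧-distribʳ-xor (δ φ x w) (eqF w y) (eqF w z))) (cong (_∧ δ φ x w) (sym (lookup∘tabulate _ w)))) ⟩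
      ΣF n (λ w → lookup Y w ∧ δ φ x w)
        ≡⟨ sum-δ x Y (subNbr-intro x Y near) (Equivalence.from T-not-≡ even) ⟩
      false ∎)
      where
      open ≡-Reasoning
      -- The symmetric difference of {y} and {z}, which is even also for y = z, when it is empty.
      Y : Vec Bool n
      Y = tabulate (λ w → eqF w y xor eqF w z)
      near : ∀ w → lookup Y w ≡ true → T (adj x w)
      near w e with w ≟ y | w ≟ z | trans (sym (lookup∘tabulate (λ w → eqF w y xor eqF w z) w)) e
      ... | yes refl | _        | _ = p
      ... | no _     | yes refl | _ = q
      ΣF-eqF-true : ∀ k → ΣF n (λ w → eqF w k) ≡ true
      ΣF-eqF-true k = trans (ΣF-cong n (λ w → sym (∧-identityʳ (eqF w k)))) (ΣF-eqF n k (λ _ → true))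
      even : oddB (count Y) ≡ false
      even = trans (oddB-count Y) (trans (ΣF-cong n (lookup∘tabulate _))
        (trans (ΣF-xor n (λ w → eqF w y) (λ w → eqF w z)) (cong₂ _xor_ (ΣF-eqF-true y) (ΣF-eqF-true z))))

    δ⇒adj : ∀ x y → δ φ x y ≡ true → T (adj x y)
    δ⇒adj x y e with T? (adj x y)
    ... | yes p = p
    ... | no ¬p = ⊥-elim (true≢false (trans (sym e) (cong₂ _xor_ (onlyIf-no _ ¬p) (onlyIf-no _ ¬p))))

    sum-δ-ends : ∀ x → ΣF n (λ y → δ φ x y ∧ ends φ true x y) ≡ false
    sum-δ-ends x with true⊎allFalse (δ φ x)
    ... | inj₂ none    = ΣF-false n (λ y → cong (_∧ ends φ true x y) (none y))
    ... | inj₁ (z , e) = trans (ΣF-cong n absorb) (sum-ends-true x)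
      where
      absorb : ∀ y → δ φ x y ∧ ends φ true x y ≡ ends φ true x y
      absorb y with T? (adj x y)
      ... | yes p = cong (_∧ ends φ true x y) (trans (δ-constant x y z p (δ⇒adj x z e)) e)
      ... | no ¬p = trans (cong (δ φ x y ∧_) (onlyIf-no _ ¬p)) (trans (∧-zeroʳ _) (sym (onlyIf-no _ ¬p)))

  x~≢y~ : x~ ≢ y~
  x~≢y~ refl = subst T (adj-irrefl x~) x~y~

  -- δ(x,y) f(b_{x,y}) sums to 0 over all (x,y), and is symmetric in x and y except at the twisted edge, where the two values differ by δ.
  twisted-δ : ∀ {φ} → Local tilde φ → δ φ x~ y~ ≡ false
  twisted-δ {φ} L = begin
    d                                                     ≡⟨ sym total-e ⟩
    ΣF n (λ x → ΣF n (λ y → e x y ∧ d))                   ≡⟨ cong (_xor ΣF n (λ x → ΣF n (λ y → e x y ∧ d))) (sym (ΣF-false n (sum-δ-ends L))) ⟩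
    ΣF n (λ x → ΣF n (g x)) xor ΣF n (λ x → ΣF n (λ y → e x y ∧ d))
                                                          ≡⟨ sym (ΣF-xor n _ _) ⟩
    ΣF n (λ x → ΣF n (g x) xor ΣF n (λ y → e x y ∧ d))    ≡⟨ ΣF-cong n (λ x → sym (ΣF-xor n (g x) (λ y → e x y ∧ d))) ⟩
    ΣF n (λ x → ΣF n (λ y → g x y xor (e x y ∧ d)))       ≡⟨ ΣΣ-symmetric n _ symmetric diagonal ⟩
    false                                                 ∎
    where
    open ≡-Reasoning
    d = δ φ x~ y~
    e g : Fin n → Fin n → Bool
    -- Only one orientation of the twisted edge is marked. Adding d at this single ordered pair
    -- makes `g` symmetric, and the correction contributes exactly d to the total.
    e x y = eqF x x~ ∧ eqF y y~
    g x y = δ φ x y ∧ ends φ true x y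
    total-e : ΣF n (λ x → ΣF n (λ y → e x y ∧ d)) ≡ d
    total-e = trans (ΣF-cong n (λ x → trans (ΣF-cong n (λ y → ∧-assoc (eqF x x~) _ d)) (trans (sym (∧-ΣF n (eqF x x~) _)) (cong (eqF x x~ ∧_) (ΣF-eqF n y~ (λ _ → d))))))
      (ΣF-eqF n x~ (λ _ → d))
    split-τ : ∀ x y → tilde x y ∧ δ φ x y ≡ (e x y ∧ d) xor (e y x ∧ d)
    split-τ x y with x ≟ x~ | y ≟ y~ | x ≟ y~ | y ≟ x~
    ... | yes refl | yes refl | yes p    | _        = contradiction p x~≢y~
    ... | yes refl | yes refl | no _     | yes p    = contradiction (sym p) x~≢y~
    ... | yes refl | yes refl | no _     | no _     = sym (xor-identityʳ d)
    ... | yes refl | no _     | yes p    | _        = contradiction p x~≢y~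
    ... | yes refl | no _     | no _     | yes _    = refl
    ... | yes refl | no _     | no _     | no _     = refl
    ... | no _     | _        | yes refl | yes refl = δ-sym L x~ y~
    ... | no _     | _        | yes refl | no _     = refl
    ... | no _     | _        | no _     | yes _    = refl
    ... | no _     | _        | no _     | no _     = refl
    g-reverse : ∀ x y → g y x ≡ g x y xor (tilde x y ∧ δ φ x y)
    g-reverse x y = trans (cong₂ _∧_ (δ-sym L x y) (ends-reverse L x y)) (distrib (δ φ x y) (ends φ true x y) (tilde x y))
      where
      distrib : ∀ p q t → p ∧ (q xor (t ∧ p)) ≡ (p ∧ q) xor (t ∧ p)
      distrib true  q t = refl
      distrib false q t = sym (∧-zeroʳ t)
    symmetric : ∀ x y → g x y xor (e x y ∧ d) ≡ g y x xor (e y x ∧ d)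
    symmetric x y = sym (trans (cong (_xor (e y x ∧ d)) (trans (g-reverse x y) (cong (g x y xor_) (split-τ x y))))
      (cancel (g x y) (e x y ∧ d) (e y x ∧ d)))
      where
      cancel : ∀ p q r → (p xor (q xor r)) xor r ≡ p xor q
      cancel p q r = trans (xor-assoc p (q xor r) r) (cong (p xor_) (trans (xor-assoc q r r) (trans (cong (q xor_) (xor-same r)) (xor-identityʳ q))))
    diagonal : ∀ x → g x x xor (e x x ∧ d) ≡ false
    diagonal x = cong₂ _xor_
      (trans (cong (δ φ x x ∧_) (onlyIf-no _ (λ t → subst T (adj-irrefl x) t))) (∧-zeroʳ _))
      (cong (_∧ d) off)
      where
      off : e x x ≡ false
      off with x ≟ x~ | x ≟ y~
      ... | yes refl | yes p = contradiction p x~≢y~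
      ... | yes _    | no _  = refl
      ... | no _     | _     = refl

  -- Where δ = 0 the a- and b-values at the far end coincide, so `on-edge` holds there with either
  -- twist; the other two conditions do not involve τ.
  Local-retwist : ∀ {τ τ′ φ} → (∀ x y → τ x y ≡ τ′ x y ⊎ δ φ y x ≡ false) → Local τ φ → Local τ′ φ
  Local-retwist {τ} {τ′} {φ} h L = record
    { on-c    = on-c L
    ; on-edge = λ s x y p q → trans (change s x y q (h x y)) (on-edge L s x y p q)
    ; at-c    = at-c L
    }
    where
    change : ∀ s x y q → τ x y ≡ τ′ x y ⊎ δ φ y x ≡ false → φ (side (s xor τ′ x y) y x q) ≡ φ (side (s xor τ x y) y x q)
    change s x y q (inj₁ e) = cong (λ t → φ (side (s xor t) y x q)) (sym e)
    change s x y q (inj₂ e) = any (s xor τ′ x y) (s xor τ x y)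
      where
      ab : φ (a y x q) ≡ φ (b y x q)
      ab = xor≡false⇒≡ _ _ (trans (sym (cong₂ _xor_ (onlyIf-yes (φ ∘ a y x) q) (onlyIf-yes (φ ∘ b y x) q))) e)
      any : ∀ s s′ → φ (side s y x q) ≡ φ (side s′ y x q)
      any false false = refl
      any false true  = ab
      any true  false = sym ab
      any true  true  = refl

  tilde-cases : ∀ {τ φ} → Local τ φ → δ φ x~ y~ ≡ false → ∀ x y → tilde x y ≡ false ⊎ δ φ y x ≡ false
  tilde-cases L e x y with x ≟ x~ | y ≟ y~ | x ≟ y~ | y ≟ x~
  ... | yes refl | yes refl | _        | _        = inj₂ (trans (δ-sym L x~ y~) e)
  ... | yes _    | no _     | yes refl | yes refl = inj₂ e
  ... | yes _    | no _     | yes _    | no _     = inj₁ refl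
  ... | yes _    | no _     | no _     | _        = inj₁ refl
  ... | no _     | _        | yes refl | yes refl = inj₂ e
  ... | no _     | _        | yes _    | no _     = inj₁ refl
  ... | no _     | _        | no _     | _        = inj₁ refl

  untwist : ∀ {φ} → Local tilde φ → Local untwisted φ
  untwist L = Local-retwist (tilde-cases L (twisted-δ L)) L

  twist : ∀ {φ} → δ φ x~ y~ ≡ false → Local untwisted φ → Local tilde φ
  twist e L = Local-retwist (λ x y → Sum.map₁ sym (tilde-cases L e x y)) L

  isA : Vtx → Bool
  isA (c _ _ _ _) = false
  isA (a _ _ _)   = true
  isA (b _ _ _)   = false

  -- Exactly the edges in Y join c_{x,Y} to an a-vertex, so the sum there is the parity of Y, which
  -- is even.
  isA-Local : Local untwisted isA
  isA-Local = record
    { on-c    = λ _ _ _ _ → refl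
    ; on-edge = λ { false _ _ _ _ → refl ; true _ _ _ _ → refl }
    ; at-c    = λ x Y p q → trans (ΣF-cong n (member x Y p)) (trans (sym (oddB-count Y)) (Equivalence.to T-not-≡ q))
    }
    where
    member : ∀ x Y → T (subNbr x Y) → ∀ y → ends isA (not (lookup Y y)) x y ≡ lookup Y y
    member x Y p y with lookup Y y in e | T? (adj x y)
    ... | true  | _     = onlyIf-yes (isA ∘ a x y) (subNbr-elim x Y p y e)
    ... | false | yes t = onlyIf-yes (isA ∘ b x y) t
    ... | false | no ¬t = onlyIf-no _ ¬t

  -- Comparison of the two solution spaces

  f₀ : Vec Bool N
  f₀ = tabulate (isA ∘ lab)

  δ-f₀ : δ (value f₀) x~ y~ ≡ true
  δ-f₀ = cong₂ _xor_
    (trans (onlyIf-yes _ x~y~) (at (a x~ y~ x~y~)))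
    (trans (onlyIf-yes _ x~y~) (at (b x~ y~ x~y~)))
    where
    at : ∀ v → value f₀ v ≡ isA v
    at v = trans (lookup∘tabulate _ (to v)) (cong isA (lab-to v))

  value-lab : ∀ f i → lookup f i ≡ value f (lab i)
  value-lab f i = cong (lookup f) (sym (to-lab i))

  f₀∈Sol : Sol Eg f₀
  f₀∈Sol = Local⇒Sol Eg-spec f₀ isA (lookup∘tabulate _) isA-Local

  f₀∉Sol′ : ¬ Sol Eg' f₀
  f₀∉Sol′ S = true≢false (trans (sym δ-f₀) (twisted-δ (Sol⇒Local Eg′-spec f₀ S)))

  Sol′⊆Sol : ∀ f → Sol Eg' f → Sol Eg f
  Sol′⊆Sol f S = Local⇒Sol Eg-spec f (value f) (value-lab f) (untwist (Sol⇒Local Eg′-spec f S))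

  Sol-+ᵥ : ∀ E u v → Sol E u → Sol E v → Sol E (u +ᵥ v)
  Sol-+ᵥ E u v Su Sv i =
    trans (ΣF-cong N (λ j → trans (cong (E (lab i) (lab j) ∧_) (lookup-+ᵥ u v j)) (∧-distribˡ-xor (E (lab i) (lab j)) _ _)))
      (trans (ΣF-xor N _ _) (trans (cong₂ _xor_ (proj₁ (Su i)) (proj₁ (Sv i))) (sym (lookup-+ᵥ u v i)))) ,
    trans (cong (isX1 (lab i) ∧_) (lookup-+ᵥ u v i))
      (trans (∧-distribˡ-xor (isX1 (lab i)) _ _) (cong₂ _xor_ (proj₂ (Su i)) (proj₂ (Sv i))))

  Sol-0ᵥ : ∀ E → Sol E 0ᵥ
  Sol-0ᵥ E i =
    trans (ΣF-false N (λ j → trans (cong (E (lab i) (lab j) ∧_) (lookup-0ᵥ j)) (∧-zeroʳ _))) (sym (lookup-0ᵥ i)) ,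
    trans (cong (isX1 (lab i) ∧_) (lookup-0ᵥ i)) (∧-zeroʳ _)

  Sol? : ∀ E f → Dec (Sol E f)
  Sol? E f = all? (λ i → (_ Bool.≟ _) ×-dec (_ Bool.≟ _))

  -- Adding `f₀` changes δ at the twisted edge by 1, so f or f + `f₀` has δ = 0 there and also
  -- solves the twisted system.
  Sol-split : ∀ f → Sol Eg f → Sol Eg' f ⊎ Sol Eg' (f +ᵥ f₀)
  Sol-split f S with δ (value f) x~ y~ in e
  ... | false = inj₁ (Local⇒Sol Eg′-spec f (value f) (value-lab f) (twist e (Sol⇒Local Eg-spec f S)))
  ... | true  = inj₂ (Local⇒Sol Eg′-spec (f +ᵥ f₀) (value (f +ᵥ f₀)) (value-lab (f +ᵥ f₀))
      (twist (trans δ-+ᵥ (cong₂ _xor_ e δ-f₀)) (Sol⇒Local Eg-spec (f +ᵥ f₀) (Sol-+ᵥ Eg f f₀ S f₀∈Sol))))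
    where
    ends-+ᵥ : ∀ s → ends (value (f +ᵥ f₀)) s x~ y~ ≡ ends (value f) s x~ y~ xor ends (value f₀) s x~ y~
    ends-+ᵥ s = trans (onlyIf-cong (adj x~ y~) (λ r → lookup-+ᵥ f f₀ (to (side s x~ y~ r))))
      (onlyIf-xor (adj x~ y~) (λ r → value f (side s x~ y~ r)) (λ r → value f₀ (side s x~ y~ r)))
    δ-+ᵥ : δ (value (f +ᵥ f₀)) x~ y~ ≡ δ (value f) x~ y~ xor δ (value f₀) x~ y~
    δ-+ᵥ = trans (cong₂ _xor_ (ends-+ᵥ false) (ends-+ᵥ true)) (xor-interchange (ends (value f) false x~ y~) (ends (value f₀) false x~ y~) (ends (value f) true x~ y~) (ends (value f₀) true x~ y~))

  -- The value of the functor, its dimension, and nonisomorphism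

  open Alg N using (sem; apply; IsoC3; Vrep)
  open Representations N
  open KernelFunctor N
  open Intertwining N

  private
    adjVec : (Vtx → Vtx → Bool) → Vec Bool (N * N)
    adjVec E = tabulate (λ k → E (lab (proj₁ (remQuot {N} N k))) (lab (proj₂ (remQuot {N} N k))))
    x1Vec x2Vec : Vec Bool N
    x1Vec = tabulate (λ i → isX1 (lab i))
    x2Vec = tabulate (λ i → not (isX1 (lab i)))

  encode-edge : ∀ E i j → lookup (encode E) (edgeIx (combine i j)) ≡ E (lab i) (lab j)
  encode-edge E i j = begin
    lookup (encode E) (edgeIx (combine i j))               ≡⟨ lookup-++ˡ ((adjVec E ++ x1Vec) ++ x2Vec) _ ((combine i j ↑ˡ N) ↑ˡ N) ⟩
    _                                                      ≡⟨ lookup-++ˡ (adjVec E ++ x1Vec) x2Vec (combine i j ↑ˡ N) ⟩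
    _                                                      ≡⟨ lookup-++ˡ (adjVec E) x1Vec (combine i j) ⟩
    lookup (adjVec E) (combine i j)                        ≡⟨ lookup∘tabulate _ (combine i j) ⟩
    _                                                      ≡⟨ cong (λ p → E (lab (proj₁ p)) (lab (proj₂ p))) (remQuot-combine i j) ⟩
    E (lab i) (lab j)                                      ∎
    where open ≡-Reasoning

  encode-col : ∀ E i → lookup (encode E) (colIx i) ≡ isX1 (lab i)
  encode-col E i = begin
    lookup (encode E) (colIx i)                            ≡⟨ lookup-++ˡ ((adjVec E ++ x1Vec) ++ x2Vec) _ ((N * N ↑ʳ i) ↑ˡ N) ⟩
    _                                                      ≡⟨ lookup-++ˡ (adjVec E ++ x1Vec) x2Vec (N * N ↑ʳ i) ⟩
    _                                                      ≡⟨ lookup-++ʳ (adjVec E) x1Vec i ⟩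
    lookup x1Vec i                                         ≡⟨ lookup∘tabulate _ i ⟩
    isX1 (lab i)                                           ∎
    where open ≡-Reasoning

  encode-one : ∀ E → lookup (encode E) oneIx ≡ true
  encode-one E = lookup-++ʳ ((adjVec E ++ x1Vec) ++ x2Vec) (true ∷ []) zero

  diag-combine : ∀ i j → diag (combine i j) ≡ eqF i j
  diag-combine i j = cong (λ p → eqF (proj₁ p) (proj₂ p)) (remQuot-combine i j)

  module _ (E : Vtx → Vtx → Bool) (f : Vec Bool N) (i : Fin N) where
    open ≡-Reasoning

    lookup-adjPlusOne : ∀ j → lookup (apply adjPlusOne (encode E)) (combine i j) ≡ E (lab i) (lab j) xor eqF i j
    lookup-adjPlusOne j = begin
      lookup (apply adjPlusOne (encode E)) ij
        ≡⟨ lookup∘tabulate _ ij ⟩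
      ΣF _ (λ k → (eqF k (edgeIx ij) xor (eqF k oneIx ∧ diag ij)) ∧ lookup (encode E) k)
        ≡⟨ ΣF-cong _ (λ k → trans (∧-distribʳ-xor (lookup (encode E) k) (eqF k (edgeIx ij)) _) (cong ((eqF k (edgeIx ij) ∧ lookup (encode E) k) xor_) (∧-assoc (eqF k oneIx) (diag ij) _))) ⟩
      ΣF _ (λ k → (eqF k (edgeIx ij) ∧ lookup (encode E) k) xor (eqF k oneIx ∧ (diag ij ∧ lookup (encode E) k)))
        ≡⟨ ΣF-xor _ (λ k → eqF k (edgeIx ij) ∧ lookup (encode E) k) (λ k → eqF k oneIx ∧ (diag ij ∧ lookup (encode E) k)) ⟩
      _
        ≡⟨ cong₂ _xor_ (ΣF-eqF _ (edgeIx ij) (lookup (encode E))) (ΣF-eqF _ oneIx (λ k → diag ij ∧ lookup (encode E) k)) ⟩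
      lookup (encode E) (edgeIx ij) xor (diag ij ∧ lookup (encode E) oneIx)
        ≡⟨ cong₂ _xor_ (encode-edge E i j) (trans (cong₂ _∧_ (diag-combine i j) (encode-one E)) (∧-identityʳ _)) ⟩
      E (lab i) (lab j) xor eqF i j ∎
      where ij = combine i j

    lookup-colourDiag : ∀ j → lookup (apply colourDiag (encode E)) (combine i j) ≡ eqF i j ∧ isX1 (lab i)
    lookup-colourDiag j = begin
      lookup (apply colourDiag (encode E)) ij
        ≡⟨ lookup∘tabulate _ ij ⟩
      ΣF _ (λ k → (eqF k (colIx (row ij)) ∧ diag ij) ∧ lookup (encode E) k)
        ≡⟨ ΣF-cong _ (λ k → ∧-assoc (eqF k (colIx (row ij))) (diag ij) _) ⟩
      ΣF _ (λ k → eqF k (colIx (row ij)) ∧ (diag ij ∧ lookup (encode E) k))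
        ≡⟨ ΣF-eqF _ (colIx (row ij)) (λ k → diag ij ∧ lookup (encode E) k) ⟩
      diag ij ∧ lookup (encode E) (colIx (row ij))
        ≡⟨ cong₂ _∧_ (diag-combine i j) (trans (cong (λ p → lookup (encode E) (colIx (proj₁ p))) (remQuot-combine i j)) (encode-col E i)) ⟩
      eqF i j ∧ isX1 (lab i) ∎
      where ij = combine i j

    adjPlusOne-row : ΣF N (λ j → lookup (apply adjPlusOne (encode E)) (combine i j) ∧ lookup f j)
      ≡ ΣF N (λ j → E (lab i) (lab j) ∧ lookup f j) xor lookup f i
    adjPlusOne-row = begin
      ΣF N (λ j → lookup (apply adjPlusOne (encode E)) (combine i j) ∧ lookup f j)
        ≡⟨ ΣF-cong N (λ j → trans (cong (_∧ lookup f j) (lookup-adjPlusOne j)) (∧-distribʳ-xor (lookup f j) (E (lab i) (lab j)) _)) ⟩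
      ΣF N (λ j → (E (lab i) (lab j) ∧ lookup f j) xor (eqF i j ∧ lookup f j))
        ≡⟨ ΣF-xor N _ _ ⟩
      ΣF N (λ j → E (lab i) (lab j) ∧ lookup f j) xor ΣF N (λ j → eqF i j ∧ lookup f j)
        ≡⟨ cong (ΣF N (λ j → E (lab i) (lab j) ∧ lookup f j) xor_) (ΣF-eqF′ N i (lookup f)) ⟩
      ΣF N (λ j → E (lab i) (lab j) ∧ lookup f j) xor lookup f i ∎

    colourDiag-row : ΣF N (λ j → lookup (apply colourDiag (encode E)) (combine i j) ∧ lookup f j) ≡ isX1 (lab i) ∧ lookup f i
    colourDiag-row = begin
      ΣF N (λ j → lookup (apply colourDiag (encode E)) (combine i j) ∧ lookup f j)
        ≡⟨ ΣF-cong N (λ j → trans (cong (_∧ lookup f j) (lookup-colourDiag j)) (∧-assoc (eqF i j) _ _)) ⟩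
      ΣF N (λ j → eqF i j ∧ (isX1 (lab i) ∧ lookup f j))
        ≡⟨ ΣF-eqF′ N i _ ⟩
      isX1 (lab i) ∧ lookup f i ∎

  functor⇒Sol : ∀ E w → sem kernelFunctor (λ v → v ≡ encode E) w → Sol E (take N w) × drop N w ≡ true ∷ []
  functor⇒Sol E w s with K₁ , K₂ , w₁ ← kernelFunctor-sound (encode E) w s =
    (λ i → xor≡false⇒≡ _ _ (trans (sym (adjPlusOne-row E (take N w) i)) (K₁ i)) , trans (sym (colourDiag-row E (take N w) i)) (K₂ i)) , w₁

  Sol⇒functor : ∀ E w → Sol E (take N w) → drop N w ≡ true ∷ [] → sem kernelFunctor (λ v → v ≡ encode E) w
  Sol⇒functor E w S w₁ = kernelFunctor-complete (encode E) w
    (λ i → trans (adjPlusOne-row E (take N w) i) (≡⇒xor≡false (proj₁ (S i))))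
    (λ i → trans (colourDiag-row E (take N w) i) (proj₂ (S i))) w₁

  -- The direction space of the functor's value, which itself lies in the hyperplane with last
  -- coordinate 1; the base point in `functor-dim` is (0, 1).
  Direction : (Vtx → Vtx → Bool) → Subset (N + 1)
  Direction E z = Sol E (take N z) × drop N z ≡ false ∷ []

  take-0ᵥ : ∀ m {k} → take m (0ᵥ {m + k}) ≡ 0ᵥ
  take-0ᵥ zero    = refl
  take-0ᵥ (suc m) = cong (false ∷_) (take-0ᵥ m)

  drop-0ᵥ : ∀ m {k} → drop m (0ᵥ {m + k}) ≡ 0ᵥ
  drop-0ᵥ zero    = refl
  drop-0ᵥ (suc m) = drop-0ᵥ m

  Direction-+ᵥ : ∀ E u v → Direction E u → Direction E v → Direction E (u +ᵥ v)
  Direction-+ᵥ E u v (Su , u₁) (Sv , v₁) =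
    subst (Sol E) (sym (take-zipWith _xor_ u v)) (Sol-+ᵥ E (take N u) (take N v) Su Sv) ,
    trans (drop-zipWith _xor_ u v) (cong₂ _+ᵥ_ u₁ v₁)

  basis′ : Σ ℕ (Basis (Direction Eg'))
  basis′ = subspace-basis (N + 1) (Direction Eg')
    (λ z → Sol? Eg' (take N z) ×-dec ≡-dec Bool._≟_ (drop N z) (false ∷ []))
    (subst (Sol Eg') (sym (take-0ᵥ N)) (Sol-0ᵥ Eg') , drop-0ᵥ N)
    (Direction-+ᵥ Eg')

  basis : Basis (Direction Eg) (suc (proj₁ basis′))
  basis = basis-extend (proj₂ basis′) u
    (λ { (S , _) → f₀∉Sol′ (subst (Sol Eg') (take-++ f₀ (false ∷ [])) S) })
    (λ { z (S , z₁) → Sum.map (_, z₁)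
           (λ S′ → subst (Sol Eg') (sym (trans (take-zipWith _xor_ z u) (cong (take N z +ᵥ_) (take-++ f₀ (false ∷ []))))) S′ ,
                   trans (drop-zipWith _xor_ z u) (cong₂ _+ᵥ_ z₁ (drop-++ f₀ (false ∷ []))))
           (Sol-split (take N z) S) })
    sub
    (λ z D → Direction-+ᵥ Eg u z (subst (Sol Eg) (sym (take-++ f₀ (false ∷ []))) f₀∈Sol , drop-++ f₀ (false ∷ [])) (sub z D))
    where
    u = f₀ ++ (false ∷ [])
    sub : ∀ z → Direction Eg' z → Direction Eg z
    sub z (S , z₁) = Sol′⊆Sol (take N z) S , z₁

  functor-dim : ∀ E {m} → Basis (Direction E) m → HasDim (sem kernelFunctor (λ v → v ≡ encode E)) (just m)
  functor-dim E B = basis⇒HasDim v (basis-resp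
    (λ { z (S , z₁) → Sol⇒functor E (z +ᵥ v) (subst (Sol E) (sym (take-v z)) S) (trans (drop-v z) (cong (_+ᵥ (true ∷ [])) z₁)) })
    (λ z s → let (S , z₁) = functor⇒Sol E (z +ᵥ v) s in
       subst (Sol E) (take-v z) S , last (drop N z) (trans (sym (drop-v z)) z₁))
    B)
    where
    v : Vec Bool (N + 1)
    v = 0ᵥ {N} ++ (true ∷ [])
    take-v : ∀ z → take N (z +ᵥ v) ≡ take N z
    take-v z = trans (take-zipWith _xor_ z v) (trans (cong (take N z +ᵥ_) (take-++ (0ᵥ {N}) (true ∷ []))) (trans (+ᵥ-comm (take N z) 0ᵥ) (+ᵥ-identityˡ _)))
    drop-v : ∀ z → drop N (z +ᵥ v) ≡ drop N z +ᵥ (true ∷ [])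
    drop-v z = trans (drop-zipWith _xor_ z v) (cong (drop N z +ᵥ_) (drop-++ (0ᵥ {N}) (true ∷ [])))
    last : ∀ (x : Vec Bool 1) → x +ᵥ (true ∷ []) ≡ true ∷ [] → x ≡ false ∷ []
    last (false ∷ []) _ = refl

  pull-Sol : ∀ E E′ ψ → Alg.Hom3 N Vrep (λ v → v ≡ encode E′) (λ v → v ≡ encode E) ψ → ∀ f → Sol E f → Sol E′ (pull ψ f)
  pull-Sol E E′ ψ hom f S i =
    (begin
      ΣF N (λ j → E′ (lab i) (lab j) ∧ lookup (pull ψ f) j)
        ≡⟨ ΣF-cong N (λ j → cong (_∧ lookup (pull ψ f) j) (sym (encode-edge E′ i j))) ⟩
      ΣF N (λ j → lookup (encode E′) (edgeIx (combine i j)) ∧ lookup (pull ψ f) j)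
        ≡⟨ pull-adj (encode E) (encode E′) ψ hom f i ⟩
      Alg.sumG N (λ g → ψ g ∧ ΣF N (λ v → lookup (encode E) (edgeIx (combine (g · i) v)) ∧ lookup f v))
        ≡⟨ sumL-cong (Alg.allG N) (λ g → cong (ψ g ∧_) (trans (ΣF-cong N (λ v → cong (_∧ lookup f v) (encode-edge E (g · i) v))) (proj₁ (S (g · i))))) ⟩
      Alg.sumG N (λ g → ψ g ∧ lookup f (g · i))
        ≡⟨ sym (lookup∘tabulate _ i) ⟩
      lookup (pull ψ f) i ∎) ,
    trans (cong (_∧ lookup (pull ψ f) i) (sym (encode-col E′ i))) (trans (pull-col (encode E) (encode E′) ψ hom f i)
      (sumL-false (Alg.allG N) (λ g → trans (cong (ψ g ∧_) (trans (cong (_∧ lookup f (g · i)) (encode-col E (g · i))) (proj₂ (S (g · i))))) (∧-zeroʳ _))))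
    where open ≡-Reasoning

  notIso : ¬ IsoC3 Vrep (λ v → v ≡ AΓ) (λ v → v ≡ AΓ')
  -- Since `pull` is contravariant, it is the morphism ψ from A_Γ′ to A_Γ that carries solutions for
  -- Γ to solutions for Γ′, and the identity for `comp3 ψ φ` makes `pull φ` a left inverse of
  -- `pull ψ`.
  notIso (φ , ψ , _ , homψ , ψφ , _) = f₀∉Sol′ (injective-recurrent {P = Sol Eg} {P′ = Sol Eg'} (pull ψ)
    (pull-injective ψ φ ψφ) (pull-Sol Eg Eg' ψ homψ) Sol′⊆Sol f₀ f₀∈Sol)

theorem1p11 : (n : ℕ) (adj : Fin n → Fin n → Bool) →
    ((x y : Fin n) → adj x y ≡ adj y x) → ((x : Fin n) → adj x x ≡ false) →
    (x~ y~ : Fin n) → T (adj x~ y~) →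
    (N : ℕ) (π : CFIV.Vtx n adj ↔ Fin N) →
    ¬ CFI.ColIso n adj x~ y~ →
    (Σ (Alg.Rep N) λ V' → Σ (Alg.Variance N) λ s → Σ (Alg.CFun N (Alg.Vrep N) V' s) λ F →
    Σ (Maybe ℕ) λ m → Σ (Maybe ℕ) λ m' →
    HasDim (Alg.sem N F (λ v → v ≡ CFIA.AΓ n adj x~ y~ N π)) m ×
    HasDim (Alg.sem N F (λ v → v ≡ CFIA.AΓ' n adj x~ y~ N π)) m' ×
    m ≢ m')
    × ¬ Alg.IsoC3 N (Alg.Vrep N) (λ v → v ≡ CFIA.AΓ n adj x~ y~ N π) (λ v → v ≡ CFIA.AΓ' n adj x~ y~ N π)
theorem1p11 n adj adj-sym adj-irrefl x~ y~ x~y~ N π _ =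
  -- The dimensions differ by exactly one: `basis` is the basis for Γ′ with one vector added, coming
  -- from `f₀`.
  (_ , _ , KernelFunctor.kernelFunctor N , _ , _ ,
    functor-dim (CFI.Eg n adj x~ y~) basis , functor-dim (CFI.Eg' n adj x~ y~) (proj₂ basis′) , 1+n≢n ∘ just-injective) ,
  notIso
  where open CFISolutions n adj adj-sym adj-irrefl x~ y~ x~y~ N π
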